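{- Let $G$ be an optimal minimally $2$-connected graph of order $n \ge 5$. Then $G$ is bipartite with partite sets the set of vertices of degree $2$ and the set of vertices of degree exceeding $2$.
   Context: Graphs are finite and may have multiple edges but no loops; the degree of a vertex counts edges with multiplicity, and the order of a graph is its number of vertices. For distinct vertices $u,v$ of a graph $G$, $\kappa_G(u,v)$ denotes the maximum number of internally disjoint $u$--$v$ paths in $G$ (a set of $u$--$v$ paths is internally disjoint if no two of them share an edge or a vertex other than $u,v$). The average connectivity of a graph $G$ of order $n$ is $\overline{\kappa}(G)=\sum_{\{u,v\}\subseteq V(G)}\kappa_G(u,v)/\binom{n}{2}$. The connectivity $\kappa(G)$ of a non-trivial graph $G$ is the smallest number of vertices whose removal disconnects $G$ or produces the trivial (one-vertex) graph. A graph $G$ is minimally $2$-connected if $\kappa(G)=2$ and $\kappa(G-e)<2$ for every edge $e$ of $G$. A minimally $2$-connected graph $G$ of order $n$ is called optimal if it has maximum average connectivity among all minimally $2$-connected graphs of order $n$. -}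

module Defs where

open import Axiom.UniquenessOfIdentityProofs using (module Decidable⇒UIP)
open import Data.Fin.Base as Fin using (Fin; zero; suc; toℕ; fromℕ<)
open import Data.Fin.Properties as Fin using (any?; all?; injective⇒≤)
open import Data.Fin.Subset as Subset using (Subset; ∣_∣; ∁; ⁅_⁆)
open import Data.Fin.Subset.Properties as Subset using (anySubset?; ∣⊥∣≡0)
open import Data.Integer.Base using (+_)
open import Data.List.Base as List using (List; length; filter; removeAt)
open import Data.Nat.Base as ℕ using (ℕ; zero; suc; _+_; _∸_; _≤_; _<_; z≤n; s≤s; NonZero; NonTrivial)
open import Data.Nat.Combinatorics using (_C_; nC1≡n; nCk+nC[k+1]≡[n+1]C[k+1])
open import Data.Nat.Properties as ℕ using (+-0-monoid; ≤-refl; ≤-trans; m≤n⇒m<n∨m≡n)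
open import Algebra.Properties.Monoid.Sum +-0-monoid using (sum-syntax)
open import Data.Product.Base using (Σ; ∃; _×_; _,_; proj₁; proj₂; map₂)
open import Data.Rational.Base as ℚ using (ℚ)
open import Data.Sum.Base using (_⊎_; inj₁; inj₂; [_,_])
open import Data.Vec.Base using (Vec; []; _∷_; map)
open import Data.Vec.Membership.Propositional using (_∈_; _∉_)
open import Data.Vec.Relation.Unary.All as All using (All)
open import Data.Vec.Relation.Unary.Any using (here)
open import Data.Vec.Relation.Unary.AllPairs as AllPairs using (AllPairs)
open import Data.Vec.Relation.Unary.AllPairs.Properties using (map⁺)
open import Data.Vec.Relation.Unary.Unique.Propositional using (Unique)
open import Data.Vec.Relation.Unary.Unique.Propositional.Properties using (lookup-injective)
open import Level using (0ℓ)
open import Relation.Binary.PropositionalEquality using (_≡_; _≢_; refl; sym; trans; cong; subst)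
open import Relation.Nullary using (¬_; Dec; yes; no; Irrelevant; contradiction)
open import Relation.Nullary.Decidable using (map′; ¬?; _×-dec_; _⊎-dec_; _→-dec_)
open import Relation.Unary using (Pred; Decidable)

import Data.Vec.Membership.DecPropositional as DecMembership
open module ∈-Fin {n} = DecMembership (Fin._≟_ {n}) using (_∈?_)

private
  variable
    n k : ℕ

-- The choice of which end is the source carries no meaning; everything
-- below treats the two ends symmetrically.
record Edge (n : ℕ) : Set where
  constructor edge
  field
    source  : Fin n
    target  : Fin n
    no-loop : source ≢ target

open Edge public

-- Loopless multigraphs of order n. Edges are identified by their position
-- in the list, so repeated entries are parallel edges.
Graph : ℕ → Set
Graph n = List (Edge n)

EdgeOf : Graph n → Set
EdgeOf G = Fin (length G)

deleteEdge : (G : Graph n) → EdgeOf G → Graph n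
deleteEdge = removeAt

Joins : Edge n → Fin n → Fin n → Set
Joins e u v = (source e ≡ u × target e ≡ v) ⊎ (source e ≡ v × target e ≡ u)

Incident : Fin n → Edge n → Set
Incident v e = source e ≡ v ⊎ target e ≡ v

incident? : (v : Fin n) → Decidable (Incident v)
incident? v e = (source e Fin.≟ v) ⊎-dec (target e Fin.≟ v)

degree : Graph n → Fin n → ℕ
degree G v = length (filter (incident? v) G)

data Walk (G : Graph n) : ℕ → Fin n → Fin n → Set where
  stop : ∀ {u} → Walk G 0 u u
  step : ∀ {u w v} (e : EdgeOf G) → Joins (List.lookup G e) u w →
         Walk G k w v → Walk G (suc k) u v

walkVertices : ∀ {G : Graph n} {u v} → Walk G k u v → Vec (Fin n) (suc k)
walkVertices {u = u} stop         = u ∷ []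
walkVertices {u = u} (step _ _ w) = u ∷ walkVertices w

walkEdges : ∀ {G : Graph n} {u v} → Walk G k u v → Vec (EdgeOf G) k
walkEdges stop         = []
walkEdges (step e _ w) = e ∷ walkEdges w

record Path (G : Graph n) (u v : Fin n) : Set where
  constructor path
  field
    size   : ℕ
    walk   : Walk G size u v
    simple : Unique (walkVertices walk)

  vertices : Vec (Fin n) (suc size)
  vertices = walkVertices walk

  edges : Vec (EdgeOf G) size
  edges = walkEdges walk

open Path public

InternallyDisjoint : ∀ {G : Graph n} {u v} → Path G u v → Path G u v → Set
InternallyDisjoint {u = u} {v} p q =
  (∀ e → e ∈ edges p → e ∉ edges q) ×
  (∀ w → w ∈ vertices p → w ∈ vertices q → w ≡ u ⊎ w ≡ v)

DisjointPaths : (G : Graph n) (u v : Fin n) → ℕ → Set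
DisjointPaths G u v k = Σ (Vec (Path G u v) k) (AllPairs InternallyDisjoint)

-- ConnectedWithout G S says that G − S is connected: the paths of G − S
-- are the paths of G that avoid S.
ConnectedWithout : Graph n → Subset n → Set
ConnectedWithout G S = ∀ u v → u Subset.∉ S → v Subset.∉ S →
  Σ (Path G u v) λ p → All (Subset._∉ S) (vertices p)

-- Deleting some k vertices disconnects G or leaves a single vertex.
Cut : Graph n → ℕ → Set
Cut G k = ∃ λ S → ∣ S ∣ ≡ k × (¬ ConnectedWithout G S ⊎ ∣ ∁ S ∣ ≡ 1)

IsMaximum IsMinimum : Pred ℕ 0ℓ → ℕ → Set
IsMaximum P k = P k × ∀ j → P j → j ≤ k
IsMinimum P k = P k × ∀ j → P j → k ≤ j

maximum : ∀ {P} → Decidable P → P 0 → ∀ b → (∀ j → P j → j ≤ b) → ∃ (IsMaximum P)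
maximum P? P0 zero    bound = 0 , P0 , bound
maximum {P} P? P0 (suc b) bound with P? (suc b)
... | yes Pb = suc b , Pb , bound
... | no ¬Pb = maximum P? P0 b bound′
  where
  bound′ : ∀ j → P j → j ≤ b
  bound′ j Pj with m≤n⇒m<n∨m≡n (bound j Pj)
  ... | inj₁ (s≤s j≤b) = j≤b
  ... | inj₂ refl      = contradiction Pj ¬Pb

minimum : ∀ {P} → Decidable P → ∃ P → ∃ (IsMinimum P)
minimum {P} P? (m , Pm) = search m 0 (ℕ.+-identityʳ m) λ _ _ → z≤n
  where
  search : ∀ d i → d + i ≡ m → (∀ j → P j → i ≤ j) → ∃ (IsMinimum P)
  search zero    i refl below = i , Pm , below
  search (suc d) i eq   below with P? i
  ... | yes Pi = i , Pi , below
  ... | no ¬Pi = search d (suc i) (trans (ℕ.+-suc d i) eq) below′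
    where
    below′ : ∀ j → P j → suc i ≤ j
    below′ j Pj with m≤n⇒m<n∨m≡n (below j Pj)
    ... | inj₁ i<j  = i<j
    ... | inj₂ refl = contradiction Pj ¬Pi

-- Graphs, walks and paths are searched exhaustively, so that the maxima and
-- minima defining κ and connectivity exist constructively.

Searchable : Set → Set₁
Searchable A = ∀ {Q : A → Set} → Decidable Q → Dec (∃ Q)

private
  search-prop : ∀ {A} → Dec A → Irrelevant A → Searchable A
  search-prop (no ¬a) _   Q? = no λ (a , _) → ¬a a
  search-prop (yes a) irr {Q} Q? =
    map′ (a ,_) (λ (b , Qb) → subst Q (irr b a) Qb) (Q? a)

  search-≡ : (u v : Fin n) → Searchable (u ≡ v)
  search-≡ u v = search-prop (u Fin.≟ v) (Decidable⇒UIP.≡-irrelevant Fin._≟_)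

  search-Σ : ∀ {A} {B : A → Set} → Searchable A → (∀ a → Searchable (B a)) → Searchable (Σ A B)
  search-Σ sA sB Q? =
    map′ (λ (a , b , q) → (a , b) , q) (λ ((a , b) , q) → a , b , q)
         (sA λ a → sB a λ b → Q? (a , b))

  search-⊎ : ∀ {A B} → Searchable A → Searchable B → Searchable (A ⊎ B)
  search-⊎ sA sB Q? =
    map′ [ (λ (a , q) → inj₁ a , q) , (λ (b , q) → inj₂ b , q) ]
         (λ { (inj₁ a , q) → inj₁ (a , q) ; (inj₂ b , q) → inj₂ (b , q) })
         (sA (λ a → Q? (inj₁ a)) ⊎-dec sB (λ b → Q? (inj₂ b)))

  search-Joins : ∀ (e : Edge n) u v → Searchable (Joins e u v)
  search-Joins e u v = search-⊎
    (search-Σ (search-≡ _ _) λ _ → search-≡ _ _)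
    (search-Σ (search-≡ _ _) λ _ → search-≡ _ _)

  search-Walk : ∀ (G : Graph n) k u v → Searchable (Walk G k u v)
  search-Walk G zero    u v Q? with u Fin.≟ v
  ... | yes refl = map′ (stop ,_) (λ { (stop , q) → q }) (Q? stop)
  ... | no u≢v   = no λ { (stop , _) → u≢v refl }
  search-Walk G (suc k) u v Q? =
    map′ (λ (e , w , j , r , q) → step e j r , q)
         (λ { (step e j r , q) → e , _ , j , r , q })
         (any? λ e → any? λ w → search-Joins (List.lookup G e) u w λ j →
          search-Walk G k w v λ r → Q? (step e j r))

  unique? : Decidable (Unique {A = Fin n} {k})
  unique? = AllPairs.allPairs? λ u v → ¬? (u Fin.≟ v)

  unique-length : {us : Vec (Fin n) k} → Unique us → k ≤ n
  unique-length us! = injective⇒≤ λ {i} {j} → lookup-injective us! i j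

search-Path : ∀ (G : Graph n) u v → Searchable (Path G u v)
search-Path {n} G u v {Q} Q? = map′ to from
  (any? λ i → search-Walk G (toℕ i) u v λ w →
   search-prop (unique? _) (AllPairs.irrelevant λ _ _ → refl) λ w! → Q? (path (toℕ i) w w!))
  where
  Found : ℕ → Set
  Found k = Σ (Walk G k u v) λ w → Σ (Unique (walkVertices w)) λ w! → Q (path k w w!)

  to : (∃ λ (i : Fin n) → Found (toℕ i)) → ∃ Q
  to (i , w , w! , q) = path (toℕ i) w w! , q

  from : ∃ Q → ∃ λ (i : Fin n) → Found (toℕ i)
  from (path k w w! , q) =
    fromℕ< (unique-length w!) ,
    subst Found (sym (Fin.toℕ-fromℕ< (unique-length w!))) (w , w! , q)

search-Vec : ∀ {A} → Searchable A → ∀ k → Searchable (Vec A k)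
search-Vec sA zero    Q? = map′ ([] ,_) (λ { ([] , q) → q }) (Q? [])
search-Vec sA (suc k) Q? =
  map′ (λ (x , xs , q) → x ∷ xs , q) (λ { (x ∷ xs , q) → x , xs , q })
       (sA λ x → search-Vec sA k λ xs → Q? (x ∷ xs))

disjointPaths? : ∀ (G : Graph n) u v → Decidable (DisjointPaths G u v)
disjointPaths? G u v k =
  search-Vec (search-Path G u v) k (AllPairs.allPairs? λ p q →
    all? (λ e → (e ∈? edges p) →-dec ¬? (e ∈? edges q)) ×-dec
    all? (λ w → (w ∈? vertices p) →-dec (w ∈? vertices q) →-dec
                ((w Fin.≟ u) ⊎-dec (w Fin.≟ v))))

connectedWithout? : (G : Graph n) → Decidable (ConnectedWithout G)
connectedWithout? G S =
  all? λ u → all? λ v → ¬? (u Subset.∈? S) →-dec ¬? (v Subset.∈? S) →-dec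
  search-Path G u v λ p → All.all? (λ w → ¬? (w Subset.∈? S)) (vertices p)

cut? : (G : Graph n) → Decidable (Cut G)
cut? G k = anySubset? λ S →
  (∣ S ∣ ℕ.≟ k) ×-dec (¬? (connectedWithout? G S) ⊎-dec (∣ ∁ S ∣ ℕ.≟ 1))

private
  firstEdge : ∀ {G : Graph n} {u v} → u ≢ v → (p : Path G u v) → Σ (EdgeOf G) (_∈ edges p)
  firstEdge u≢v (path _ stop         _) = contradiction refl u≢v
  firstEdge u≢v (path _ (step e _ _) _) = e , here refl

  disjointPaths-bound : ∀ (G : Graph n) {u v} → u ≢ v → ∀ k → DisjointPaths G u v k → k ≤ length G
  disjointPaths-bound G u≢v k (ps , ps!) = unique-length
    {us = map (λ p → proj₁ (firstEdge u≢v p)) ps}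
    (map⁺ (AllPairs.map (λ {p} {q} → distinct p q) ps!))
    where
    distinct : ∀ p q → InternallyDisjoint p q →
               proj₁ (firstEdge u≢v p) ≢ proj₁ (firstEdge u≢v q)
    distinct p q (disjoint , _) eq =
      disjoint _ (proj₂ (firstEdge u≢v p))
                 (subst (_∈ edges q) (sym eq) (proj₂ (firstEdge u≢v q)))

  cut-exists : ∀ (G : Graph n) → n ℕ.> 1 → ∃ (Cut G)
  cut-exists {suc n} G _ = _ , ∁ ⁅ zero ⁆ , refl , inj₂ 1-left
    where
    1-left : ∣ ∁ (∁ ⁅ zero {n} ⁆) ∣ ≡ 1
    1-left rewrite Subset.∣∁p∣≡n∸∣p∣ (∁ ⁅ zero {n} ⁆) | Subset.∣∁p∣≡n∸∣p∣ ⁅ zero {n} ⁆ | ∣⊥∣≡0 n =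
      ℕ.m+n∸n≡m 1 n

-- u ≢ v is needed: the trivial path from u to u is internally disjoint from
-- itself, so there the families would be unbounded.
κ-maximum : ∀ (G : Graph n) {u v} → u ≢ v → ∃ (IsMaximum (DisjointPaths G u v))
κ-maximum G {u} {v} u≢v =
  maximum (disjointPaths? G u v) ([] , AllPairs.[]) (length G) (disjointPaths-bound G u≢v)

κ : (G : Graph n) {u v : Fin n} → u ≢ v → ℕ
κ G u≢v = proj₁ (κ-maximum G u≢v)

connectivity-minimum : (G : Graph n) .{{_ : NonTrivial n}} → ∃ (IsMinimum (Cut G))
connectivity-minimum {n} G = minimum (cut? G) (cut-exists G (ℕ.nonTrivial⇒n>1 n))

connectivity : (G : Graph n) .{{_ : NonTrivial n}} → ℕ
connectivity G = proj₁ (connectivity-minimum G)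

nC2-nonZero : ∀ n .{{_ : NonTrivial n}} → NonZero (n C 2)
nC2-nonZero (suc (suc m)) = subst NonZero
  (trans (cong (_+ suc m C 2) (sym (nC1≡n (suc m)))) (nCk+nC[k+1]≡[n+1]C[k+1] (suc m) 1)) _

-- Each unordered pair {u , v} is counted once, at u < v.
pairConnectivity : (G : Graph n) → Fin n → Fin n → ℕ
pairConnectivity G u v with u Fin.<? v
... | yes u<v = κ G (Fin.<⇒≢ u<v)
... | no  _   = 0

totalConnectivity : Graph n → ℕ
totalConnectivity {n} G = ∑[ u < n ] ∑[ v < n ] pairConnectivity G u v

averageConnectivity : (G : Graph n) .{{_ : NonTrivial n}} → ℚ
averageConnectivity {n} G = (+ totalConnectivity G) ℚ./ (n C 2)
  where instance _ = nC2-nonZero n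

MinimallyTwoConnected : (G : Graph n) .{{_ : NonTrivial n}} → Set
MinimallyTwoConnected G =
  connectivity G ≡ 2 × (∀ e → connectivity (deleteEdge G e) < 2)

Optimal : (G : Graph n) .{{_ : NonTrivial n}} → Set
Optimal {n} G = MinimallyTwoConnected G ×
  (∀ (H : Graph n) → MinimallyTwoConnected H → averageConnectivity H ℚ.≤ averageConnectivity G)

record BipartiteWithPartiteSets (G : Graph n) (A B : Pred (Fin n) 0ℓ) : Set where
  field
    cover    : ∀ v → A v ⊎ B v
    disjoint : ∀ v → ¬ (A v × B v)
    crossing : ∀ (e : EdgeOf G) u v → Joins (List.lookup G e) u v →
               (A u × B v) ⊎ (B u × A v)

{-# OPTIONS --safe #-}
module Submission where

open import Defs
open ∈-Fin using (_∈?_)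
import Algebra.Properties.CommutativeMonoid.Sum as Sum
open import Data.Bool.Base using (Bool; true; false)
import Data.Bool.Properties as Bool
open import Data.Empty using (⊥; ⊥-elim)
open import Data.Fin.Base as Fin using (Fin; zero; suc; punchIn; punchOut)
open import Data.Fin.Permutation.Components using (transpose; transpose-inverse)
import Data.Fin.Properties as Fin
open import Data.Fin.Properties using (_≟_; any?; injective⇒≤)
open import Data.Fin.Subset as Subset using (Subset; ∣_∣; ∁; ⁅_⁆; _∪_)
import Data.Fin.Subset.Properties as Subset
open import Data.Integer.Base as ℤ using ()
import Data.Integer.Properties as ℤ
open import Data.List.Base as List
  using (List; []; _∷_; length; lookup; removeAt; filter; _++_; map; reverse; reverseAcc; allFin)
import Data.List.Membership.DecPropositional as ListDec
open import Data.List.Membership.Propositional using (_∈_; _∉_)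
open import Data.List.Membership.Propositional.Properties using (∈-map⁻; ∈-filter⁺; ∈-filter⁻; ∈-allFin)
import Data.List.Properties as List
open import Data.List.Relation.Binary.Permutation.Propositional using (↭⇒↭ₛ; ↭-sym)
open import Data.List.Relation.Binary.Permutation.Propositional.Properties using (↭-reverse)
import Data.List.Relation.Binary.Permutation.Setoid.Properties as Permutation
open import Data.List.Relation.Unary.All as ListAll using ([]; _∷_)
import Data.List.Relation.Unary.All.Properties as ListAll
open import Data.List.Relation.Unary.AllPairs as ListPairs using ([]; _∷_)
import Data.List.Relation.Unary.AllPairs.Properties as ListPairs
open import Data.List.Relation.Unary.Any as ListAny using (here; there)
import Data.List.Relation.Unary.Any.Properties as ListAny
import Data.List.Relation.Unary.Unique.Propositional as List
import Data.List.Relation.Unary.Unique.Propositional.Properties as ListUnique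
open import Data.Nat.Base
  using (ℕ; zero; suc; _+_; _≤_; _<_; _≥_; _>_; z≤n; s≤s; s≤s⁻¹; NonTrivial; NonZero)
open import Data.Nat.Combinatorics using (_C_)
import Data.Nat.Properties as ℕ
open import Data.Product.Base using (Σ; ∃; _×_; _,_; proj₁; proj₂)
open import Data.Rational.Base as ℚ using ()
import Data.Rational.Properties as ℚ
import Data.Rational.Unnormalised.Base as ℚᵘ
import Data.Rational.Unnormalised.Properties as ℚᵘ
open import Data.Sum.Base using (_⊎_; inj₁; inj₂; [_,_])
open import Data.Vec.Base using (Vec; []; _∷_)
open import Data.Vec.Membership.Propositional using () renaming (_∈_ to _∈ᵛ_; _∉_ to _∉ᵛ_)
open import Data.Vec.Relation.Unary.All as All using (All; []; _∷_)
open import Data.Vec.Relation.Unary.AllPairs using (AllPairs; []; _∷_)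
open import Data.Vec.Relation.Unary.Any using (here; there)
open import Data.Vec.Relation.Unary.Unique.Propositional using (Unique)
open import Function.Base using (_∘_; id)
open import Function.Bundles using (mk⇔)
open import Relation.Binary.Definitions using (tri<; tri≈; tri>)
open import Relation.Binary.PropositionalEquality
  using (_≡_; _≢_; refl; sym; trans; cong; cong₂; subst; subst₂; setoid; module ≡-Reasoning)
open import Relation.Nullary using (¬_; Dec; yes; no; contradiction; does)
open import Relation.Nullary.Decidable
  using (_⊎-dec_; _×-dec_; ¬?; does-⇔; dec-true; dec-false; decidable-stable)
open import Relation.Unary using (Decidable)

-- The proof is a surgery that increases the average connectivity. Let uv be
-- an edge and c a cut vertex of G − uv, so that G − uv is a graph A ∋ u and a
-- graph B ∋ v sharing only c, and suppose that c is adjacent to neither u nor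
-- v. Identify v with u in B, and put v back as a new vertex of degree 2 joined
-- to u and c. Thus A, B and the path u v c now lie in parallel between u and c
-- instead of forming a ring. The new graph is again minimally 2-connected. Apart
-- from {u, c} and {v, c}, no pair of vertices loses, once {y, u} and {y, v} are
-- exchanged for y in B. And κ(u, c) + κ(v, c) goes up by at least one: before the surgery it counts
-- the paths inside A and inside B and one more path each, while afterwards
-- κ(u, c) counts all paths inside A and B and u v c, and κ(v, c) ≥ 2.
-- An edge joining two vertices of degree at least 3 gives such a ring since
-- G − uv has a cut vertex and cycles of G have no chords; two adjacent vertices
-- x, y of degree 2 with other neighbours a, b give one with u = a, v = x, c = b.
--
-- Connectedness is expressed by 2-colourings: a graph minus w is connected if
-- every colouring which is constant along the edges avoiding w is constant
-- off w.

-- Colourings, rings and the surgery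

-- The condition on c is forced by minimality: the surgery would keep an edge uc and move an edge vc
-- onto uc, and such an edge would be a chord of a cycle formed by u v c and a path through A or B.
-- Up to exchanging u and v the surgery treats both sides alike. So a claim is proved for the side
-- of u and carried to the other side by the transposition of u and v. The same exchange is why a
-- single pair containing u or v may lose, and only sums over u and v are compared. A pair with one
-- vertex strictly inside each part has at most two disjoint paths, as a path between the parts that
-- avoids c has to use the edge uv. Colourings suit the gluing: a colouring of one part on which u
-- and c agree extends by a constant to everything else. Graphs of one order share the denominator
-- of the average, so totals are compared. Order at least 5 excludes the 4-cycle, whose vertices all
-- have degree 2.

Rel : ℕ → Set₁
Rel n = Fin n → Fin n → Set

SamePair : ∀ {n} (x y a b : Fin n) → Set
SamePair x y a b = (x ≡ a × y ≡ b) ⊎ (x ≡ b × y ≡ a)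

samePair-sym : ∀ {n} {x y a b : Fin n} → SamePair x y a b → SamePair a b x y
samePair-sym (inj₁ (refl , refl)) = inj₁ (refl , refl)
samePair-sym (inj₂ (refl , refl)) = inj₂ (refl , refl)

Delete : ∀ {n} → Rel n → Fin n → Fin n → Rel n
Delete E a b x y = E x y × ¬ SamePair x y a b

Monochromatic : ∀ {n} → Rel n → (Fin n → Set) → (Fin n → Bool) → Set
Monochromatic E P ψ = ∀ {x y} → E x y → P x → P y → ψ x ≡ ψ y

NoCutVertex : ∀ {n} → Rel n → Set
NoCutVertex E = ∀ w ψ → Monochromatic E (_≢ w) ψ → ∀ {x y} → x ≢ w → y ≢ w → ψ x ≡ ψ y

-- With `Delete E a b` in place of `E` this is the witness that the edge ab is critical: without it,
-- its own two ends are separated by a vertex.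
record Split {n} (E : Rel n) (a b : Fin n) : Set where
  constructor split
  field
    cutVertex : Fin n
    colour    : Fin n → Bool
    mono      : Monochromatic E (_≢ cutVertex) colour
    a≢cut     : a ≢ cutVertex
    b≢cut     : b ≢ cutVertex
    differ    : colour a ≢ colour b

-- The gluing device: a colouring of one side of a separation, made constant on the other side.
paint : ∀ {n} {P : Fin n → Set} → (∀ z → Dec (P z)) → (Fin n → Bool) → Bool → Fin n → Bool
paint P? ψ k z with P? z
... | yes _ = ψ z
... | no _  = k

module _ {n} {P : Fin n → Set} (P? : ∀ z → Dec (P z)) (ψ : Fin n → Bool) (k : Bool) where

  paint-in : ∀ {z} → P z → paint P? ψ k z ≡ ψ z
  paint-in {z} Pz with P? z
  ... | yes _  = refl
  ... | no ¬Pz = contradiction Pz ¬Pz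

  -- The hypothesis serves the vertices common to both sides, where the given colouring must already
  -- have the constant colour.
  paint-out : ∀ {z} → (P z → ψ z ≡ k) → paint P? ψ k z ≡ k
  paint-out {z} h with P? z
  ... | yes Pz = h Pz
  ... | no _   = refl

≡-or-≡ : ∀ {a b : Bool} → a ≢ b → ∀ c → c ≡ a ⊎ c ≡ b
≡-or-≡ {a} {b} a≢b c with c Bool.≟ a | c Bool.≟ b
... | yes c≡a | _       = inj₁ c≡a
... | no _    | yes c≡b = inj₂ c≡b
... | no c≢a  | no c≢b  = contradiction (trans (Bool.¬-not (c≢a ∘ sym)) (sym (Bool.¬-not (c≢b ∘ sym)))) a≢b

module _ {n} (i j : Fin n) where

  transpose-l : transpose i j i ≡ j
  transpose-l rewrite dec-true (i ≟ i) refl = refl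

  transpose-r : transpose i j j ≡ i
  transpose-r with j ≟ i
  ... | yes j≡i = j≡i
  ... | no _ rewrite dec-true (j ≟ j) refl = refl

  transpose-other : ∀ {k} → k ≢ i → k ≢ j → transpose i j k ≡ k
  transpose-other {k} k≢i k≢j rewrite dec-false (k ≟ i) k≢i | dec-false (k ≟ j) k≢j = refl

  transpose-injective : ∀ {x y} → transpose i j x ≡ transpose i j y → x ≡ y
  transpose-injective eq =
    trans (sym (transpose-inverse j i)) (trans (cong (transpose j i) eq) (transpose-inverse j i))

-- The vertex c belongs to both sides, whatever its colour.
Near : ∀ {n} → (Fin n → Bool) → Fin n → Fin n → Fin n → Set
Near φ c u x = x ≡ c ⊎ φ x ≡ φ u

near? : ∀ {n} (φ : Fin n → Bool) (c u x : Fin n) → Dec (Near φ c u x)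
near? φ c u x = (x ≟ c) ⊎-dec (φ x Bool.≟ φ u)

-- c is a cut vertex of the graph minus the edge uv, with u and v on
-- different sides.
record Ring {n} (E : Rel n) (φ : Fin n → Bool) (c u v : Fin n) : Set where
  field
    symm  : ∀ {x y} → E x y → E y x
    irr   : ∀ {x} → ¬ E x x
    u~v   : E u v
    u≢c   : u ≢ c
    v≢c   : v ≢ c
    φu≢φv : φ u ≢ φ v
    cross : ∀ {x y} → E x y → x ≢ c → y ≢ c → φ x ≡ φ y ⊎ SamePair x y u v

-- Every edge vr with r ≢ u is moved to ur, and the edge vc is added.
data Surgery {n} (E : Rel n) (φ : Fin n → Bool) (c u v : Fin n) : Rel n where
  near : ∀ {x y} → E x y → Near φ c u x → Near φ c u y → Surgery E φ c u v x y
  far  : ∀ {x y} → E x y → Near φ c v x → Near φ c v y →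
         Surgery E φ c u v (transpose u v x) (transpose u v y)
  uv   : ∀ {x y} → SamePair x y u v → Surgery E φ c u v x y
  vc   : ∀ {x y} → SamePair x y v c → Surgery E φ c u v x y

flip-ring : ∀ {n} {E : Rel n} {φ c u v} → Ring E φ c u v → Ring E φ c v u
flip-ring r = record
  { symm = symm ; irr = irr ; u~v = symm u~v ; u≢c = v≢c ; v≢c = u≢c ; φu≢φv = φu≢φv ∘ sym
  ; cross = λ e x≢c y≢c → [ inj₁ , inj₂ ∘ swap-pair ] (cross e x≢c y≢c) }
  where
  open Ring r
  swap-pair : ∀ {x y a b} → SamePair x y a b → SamePair x y b a
  swap-pair (inj₁ p) = inj₂ p
  swap-pair (inj₂ p) = inj₁ p

module _ {n} {E : Rel n} {φ : Fin n → Bool} {c u v : Fin n} (u≢c : u ≢ c) (v≢c : v ≢ c) where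

  -- Surgery looks the same from both sides, up to exchanging u and v.
  flip-surgery : ∀ {x y} → Surgery E φ c v u x y →
                 Surgery E φ c u v (transpose u v x) (transpose u v y)
  flip-surgery (near e nx ny) = far e nx ny
  flip-surgery (far e nx ny) = subst₂ (Surgery E φ c u v)
      (sym (transpose-inverse u v)) (sym (transpose-inverse u v)) (near e nx ny)
  flip-surgery (uv (inj₁ (refl , refl))) rewrite transpose-l u v | transpose-r u v = uv (inj₁ (refl , refl))
  flip-surgery (uv (inj₂ (refl , refl))) rewrite transpose-l u v | transpose-r u v = uv (inj₂ (refl , refl))
  flip-surgery (vc (inj₁ (refl , refl)))
    rewrite transpose-l u v | transpose-other u v (u≢c ∘ sym) (v≢c ∘ sym) = vc (inj₁ (refl , refl))
  flip-surgery (vc (inj₂ (refl , refl)))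
    rewrite transpose-l u v | transpose-other u v (u≢c ∘ sym) (v≢c ∘ sym) = vc (inj₂ (refl , refl))

module RingProperties {n} {E : Rel n} {φ : Fin n → Bool} {c u v : Fin n} (r : Ring E φ c u v) where

  open Ring r

  Nearu Nearv : Fin n → Set
  Nearu = Near φ c u
  Nearv = Near φ c v

  u≢v : u ≢ v
  u≢v refl = φu≢φv refl

  u-near : Nearu u
  u-near = inj₂ refl

  c-near : ∀ {z} → Near φ c z c
  c-near = inj₁ refl

  v-far : Nearv v
  v-far = inj₂ refl

  v≢near : ∀ {x} → Nearu x → x ≢ v
  v≢near (inj₁ x≡c) x≡v = v≢c (trans (sym x≡v) x≡c)
  v≢near (inj₂ eq)  x≡v = φu≢φv (trans (sym eq) (cong φ x≡v))

  u≢far : ∀ {x} → Nearv x → x ≢ u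
  u≢far (inj₁ x≡c) x≡u = u≢c (trans (sym x≡u) x≡c)
  u≢far (inj₂ eq)  x≡u = φu≢φv (trans (cong φ (sym x≡u)) eq)

  both-sides : ∀ {x} → Nearu x → Nearv x → x ≡ c
  both-sides (inj₁ x≡c) _          = x≡c
  both-sides (inj₂ _)   (inj₁ x≡c) = x≡c
  both-sides (inj₂ e)   (inj₂ e′)  = contradiction (trans (sym e) e′) φu≢φv

  side : ∀ x → Nearu x ⊎ Nearv x
  side x with ≡-or-≡ φu≢φv (φ x)
  ... | inj₁ eq = inj₁ (inj₂ eq)
  ... | inj₂ eq = inj₂ (inj₂ eq)

  classify : ∀ {x y} → E x y → (Nearu x × Nearu y) ⊎ (Nearv x × Nearv y) ⊎ SamePair x y u v
  classify {x} {y} e with x ≟ c | y ≟ c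
  ... | yes refl | _ with side y
  ...   | inj₁ ny = inj₁ (c-near , ny)
  ...   | inj₂ ny = inj₂ (inj₁ (c-near , ny))
  classify {x} {y} e | no _ | yes refl with side x
  ...   | inj₁ nx = inj₁ (nx , c-near)
  ...   | inj₂ nx = inj₂ (inj₁ (nx , c-near))
  classify {x} {y} e | no x≢c | no y≢c with cross e x≢c y≢c | side y
  ... | inj₂ same | _                 = inj₂ (inj₂ same)
  ... | inj₁ eq   | inj₁ (inj₁ y≡c)   = contradiction y≡c y≢c
  ... | inj₁ eq   | inj₂ (inj₁ y≡c)   = contradiction y≡c y≢c
  ... | inj₁ eq   | inj₁ (inj₂ ny)    = inj₁ (inj₂ (trans eq ny) , inj₂ ny)
  ... | inj₁ eq   | inj₂ (inj₂ ny)    = inj₂ (inj₁ (inj₂ (trans eq ny) , inj₂ ny))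

  -- After the surgery the two parts share only the hubs: u, which v has become, and c.
  transpose-far : ∀ {x} → Nearv x → Nearu (transpose u v x) → transpose u v x ≡ u ⊎ transpose u v x ≡ c
  transpose-far {x} far-x near-x′ with x ≟ v
  ... | yes refl = inj₁ (transpose-r u v)
  ... | no x≢v with eq ← transpose-other u v (u≢far far-x) x≢v =
    inj₂ (trans eq (both-sides (subst Nearu eq near-x′) far-x))

  nearu? : ∀ z → Dec (Nearu z)
  nearu? = near? φ c u

  -- A colouring of the side of u extends to a monochromatic colouring of
  -- the rest whenever it takes the same value k at the surviving ones of u, c.
  extend : ∀ {D : Rel n} (w : Fin n) (χ : Fin n → Bool) (k : Bool) →
    (∀ {x y} → D x y → Nearu x → Nearu y → x ≢ w → y ≢ w → χ x ≡ χ y) →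
    (u ≢ w → χ u ≡ k) → (c ≢ w → χ c ≡ k) →
    Monochromatic (Surgery D φ c u v) (_≢ w) (paint nearu? χ k)
  extend {D} w χ k inner uk ck = mono
    where
    outer : ∀ {z} → (Nearu z → z ≡ u ⊎ z ≡ c) → z ≢ w → paint nearu? χ k z ≡ k
    outer h z≢w = paint-out nearu? χ k λ nz → [ (λ { refl → uk z≢w }) , (λ { refl → ck z≢w }) ] (h nz)

    outer-v : ∀ {z} → z ≡ v → z ≢ w → paint nearu? χ k z ≡ k
    outer-v refl = outer λ nv → contradiction refl (v≢near nv)

    mono : Monochromatic (Surgery D φ c u v) (_≢ w) (paint nearu? χ k)
    mono (near e nx ny) x≢w y≢w =
      trans (paint-in nearu? χ k nx) (trans (inner e nx ny x≢w y≢w) (sym (paint-in nearu? χ k ny)))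
    mono (far e fx fy) x≢w y≢w =
      trans (outer (transpose-far fx) x≢w) (sym (outer (transpose-far fy) y≢w))
    mono (uv (inj₁ (refl , y≡v))) x≢w y≢w = trans (outer (λ _ → inj₁ refl) x≢w) (sym (outer-v y≡v y≢w))
    mono (uv (inj₂ (x≡v , refl))) x≢w y≢w = trans (outer-v x≡v x≢w) (sym (outer (λ _ → inj₁ refl) y≢w))
    mono (vc (inj₁ (x≡v , refl))) x≢w y≢w = trans (outer-v x≡v x≢w) (sym (outer (λ _ → inj₂ refl) y≢w))
    mono (vc (inj₂ (refl , y≡v))) x≢w y≢w = trans (outer (λ _ → inj₂ refl) x≢w) (sym (outer-v y≡v y≢w))

  -- The counterpart of `extend` before the surgery. Here u touches the other side only through the
  -- edge uv, so its colour is constrained only if v survives too.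
  extend-original : ∀ (w : Fin n) (χ : Fin n → Bool) (k : Bool) →
    (∀ {x y} → E x y → Nearu x → Nearu y → x ≢ w → y ≢ w → χ x ≡ χ y) →
    (u ≢ w → v ≢ w → χ u ≡ k) → (c ≢ w → χ c ≡ k) →
    Monochromatic E (_≢ w) (paint nearu? χ k)
  extend-original w χ k inner uk ck {x} {y} e x≢w y≢w with classify e
  ... | inj₁ (nx , ny) =
    trans (paint-in nearu? χ k nx) (trans (inner e nx ny x≢w y≢w) (sym (paint-in nearu? χ k ny)))
  ... | inj₂ (inj₁ (fx , fy)) = trans (outer fx x≢w) (sym (outer fy y≢w))
    where
    outer : ∀ {z} → Nearv z → z ≢ w → paint nearu? χ k z ≡ k
    outer fz z≢w = paint-out nearu? χ k λ nz → subst (λ t → χ t ≡ k) (sym (both-sides nz fz))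
      (ck (subst (_≢ w) (both-sides nz fz) z≢w))
  ... | inj₂ (inj₂ (inj₁ (refl , refl))) =
    trans (paint-out nearu? χ k λ _ → uk x≢w y≢w)
          (sym (paint-out nearu? χ k λ nv → contradiction refl (v≢near nv)))
  ... | inj₂ (inj₂ (inj₂ (refl , refl))) =
    trans (paint-out nearu? χ k λ nv → contradiction refl (v≢near nv))
          (sym (paint-out nearu? χ k λ _ → uk y≢w x≢w))

module RingChords {n} {E : Rel n} {φ : Fin n → Bool} {c u v : Fin n} (r : Ring E φ c u v) where

  open Ring r
  open RingProperties r
  private module V = RingProperties (flip-ring r)

  -- Otherwise uc is a chord of a cycle through u, u′, c and v.
  no-chord : NoCutVertex E → (E u c → Split (Delete E u c) u c) →
             ∀ {u′} → E u u′ → u′ ≢ v → u′ ≢ c → ¬ E u c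
  no-chord 2conn critical {u′} uu′ u′≢v u′≢c uc with critical uc
  ... | split w ψ mono u≢w c≢w ψu≢ψc with nearu? w
  -- The side of v is untouched by `w`. As G minus u is connected, v and c are joined inside that
  -- side, and uv completes a connection from u to c without uc.
  ...   | yes nw = ψu≢ψc (trans (mono (u~v , not-uc v≢c) u≢w (v≢near nw ∘ sym)) v-c)
    where
    not-uc : ∀ {y} → y ≢ c → ¬ SamePair u y u c
    not-uc y≢c (inj₁ (_ , y≡c)) = y≢c y≡c
    not-uc y≢c (inj₂ (u≡c , _)) = u≢c u≡c
    far≢w : ∀ {z} → Nearv z → z ≢ w
    far≢w fz refl = c≢w (sym (both-sides nw fz))
    far-mono : ∀ {x y} → E x y → Nearv x → Nearv y → x ≢ u → y ≢ u → ψ x ≡ ψ y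
    far-mono e fx fy x≢u y≢u =
      mono (e , [ (λ (x≡u , _) → x≢u x≡u) , (λ (_ , y≡u) → y≢u y≡u) ]) (far≢w fx) (far≢w fy)
    extended : Monochromatic E (_≢ u) (paint V.nearu? ψ (ψ c))
    extended = V.extend-original u ψ (ψ c) far-mono (λ _ u≢u → contradiction refl u≢u) (λ _ → refl)
    v-c : ψ v ≡ ψ c
    v-c = trans (sym (paint-in V.nearu? ψ (ψ c) v-far))
      (trans (2conn u _ extended (u≢v ∘ sym) (u≢c ∘ sym)) (paint-in V.nearu? ψ (ψ c) c-near))
  -- Now the side of u is untouched by `w`. As G minus u is connected, u′ and c are joined inside
  -- that side without u, hence without the edge uc.
  ...   | no ¬nw = ψu≢ψc (trans (mono (uu′ , not-uc) u≢w (near≢w nu′)) u′-c)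
    where
    not-uc : ¬ SamePair u u′ u c
    not-uc (inj₁ (_ , u′≡c)) = u′≢c u′≡c
    not-uc (inj₂ (u≡c , _))  = u≢c u≡c
    u′≢u : u′ ≢ u
    u′≢u refl = irr uu′
    near≢w : ∀ {z} → Nearu z → z ≢ w
    near≢w nz refl = ¬nw nz
    nu′ : Nearu u′
    nu′ with cross uu′ u≢c u′≢c
    ... | inj₁ eq               = inj₂ (sym eq)
    ... | inj₂ (inj₁ (_ , eq))  = contradiction eq u′≢v
    ... | inj₂ (inj₂ (refl , _)) = contradiction refl φu≢φv
    near-mono : ∀ {x y} → E x y → Nearu x → Nearu y → x ≢ u → y ≢ u → ψ x ≡ ψ y
    near-mono e nx ny x≢u y≢u =
      mono (e , [ (λ (x≡u , _) → x≢u x≡u) , (λ (_ , y≡u) → y≢u y≡u) ]) (near≢w nx) (near≢w ny)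
    extended : Monochromatic E (_≢ u) (paint nearu? ψ (ψ c))
    extended = extend-original u ψ (ψ c) near-mono (λ u≢u → contradiction refl u≢u) (λ _ → refl)
    u′-c : ψ u′ ≡ ψ c
    u′-c = trans (sym (paint-in nearu? ψ (ψ c) nu′))
      (trans (2conn u _ extended u′≢u (u≢c ∘ sym)) (paint-in nearu? ψ (ψ c) c-near))

module RingConnectivity {n} {E : Rel n} {φ : Fin n → Bool} {c u v : Fin n}
  (r : Ring E φ c u v) (2conn : NoCutVertex E) (u≁c : ¬ E u c) where

  open Ring r
  open RingProperties r
  private module V = RingProperties (flip-ring r)

  -- A part of this side of another colour would contain neither u nor c, so `w` would already have
  -- cut it off before the surgery.
  near-constant : ∀ {w ψ k} → Monochromatic (Surgery E φ c u v) (_≢ w) ψ →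
    (u ≢ w → ψ u ≡ k) → (c ≢ w → ψ c ≡ k) → ∀ {x} → Nearu x → x ≢ w → ψ x ≡ k
  near-constant {w} {ψ} {k} mono uk ck {x} nx x≢w =
    trans (sym (paint-in nearu? ψ k nx)) (reference (w ≟ v))
    where
    extended : Monochromatic E (_≢ w) (paint nearu? ψ k)
    extended = extend-original w ψ k (λ e nx ny → mono (near e nx ny)) (λ u≢w _ → uk u≢w) ck

    -- A surviving vertex that certainly has colour `k`: v, which is painted, or c when v is the
    -- deleted vertex.
    reference : Dec (w ≡ v) → paint nearu? ψ k x ≡ k
    reference (yes refl) = trans (2conn w _ extended x≢w (v≢c ∘ sym))
      (paint-out nearu? ψ k λ _ → ck (v≢c ∘ sym))
    reference (no w≢v)   = trans (2conn w _ extended x≢w (w≢v ∘ sym))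
      (paint-out nearu? ψ k λ nv → contradiction refl (v≢near nv))

  -- If both hubs survive, the path u v c gives them the same colour. If v is deleted, the side of u
  -- does: in the original graph without v, that side can be left only through c. A deleted hub
  -- imposes nothing, so the other one supplies `k`.
  hub-colour : ∀ {w ψ} → Monochromatic (Surgery E φ c u v) (_≢ w) ψ →
    ∃ λ k → (u ≢ w → ψ u ≡ k) × (c ≢ w → ψ c ≡ k)
  hub-colour {w} {ψ} mono with u ≟ w | c ≟ w | v ≟ w
  ... | yes u≡w | _       | _      = ψ c , contradiction u≡w , λ _ → refl
  ... | no _    | yes c≡w | _      = ψ u , (λ _ → refl) , contradiction c≡w
  ... | no u≢w  | no c≢w  | no v≢w = ψ c ,
    (λ _ → trans (mono (uv (inj₁ (refl , refl))) u≢w v≢w) (mono (vc (inj₁ (refl , refl))) v≢w c≢w)) ,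
    λ _ → refl
  ... | no u≢w  | no c≢w  | yes refl = ψ c , (λ _ → u-c) , λ _ → refl
    where
    extended : Monochromatic E (_≢ w) (paint nearu? ψ (ψ c))
    extended = extend-original w ψ (ψ c) (λ e nx ny → mono (near e nx ny))
      (λ _ v≢v → contradiction refl v≢v) (λ _ → refl)
    u-c : ψ u ≡ ψ c
    u-c = trans (sym (paint-in nearu? ψ (ψ c) u-near))
      (trans (2conn w _ extended u≢w c≢w) (paint-in nearu? ψ (ψ c) c-near))

  module _ {a b} (na : Nearu a) (nb : Nearu b) (e : E a b) where

    -- The colouring has to be good on the side of u only. Everything else is painted with the
    -- common colour of u and c, or with the colour of the hub that survives.
    split-surgery-with : ∀ {w} {ψ : Fin n → Bool} →
      (∀ {x y} → Delete E a b x y → Nearu x → Nearu y → x ≢ w → y ≢ w → ψ x ≡ ψ y) →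
      (u ≢ w → c ≢ w → ψ u ≡ ψ c) → a ≢ w → b ≢ w → ψ a ≢ ψ b →
      Split (Surgery (Delete E a b) φ c u v) a b
    split-surgery-with {w} {ψ} inner ends a≢w b≢w differ with u ≟ w
    ... | yes u≡w = split w (paint nearu? ψ (ψ c))
      (extend w ψ (ψ c) inner (contradiction u≡w) (λ _ → refl)) a≢w b≢w
      λ eq → differ (trans (sym (paint-in nearu? ψ _ na)) (trans eq (paint-in nearu? ψ _ nb)))
    ... | no u≢w = split w (paint nearu? ψ (ψ u))
      (extend w ψ (ψ u) inner (λ _ → refl) (λ c≢w → sym (ends u≢w c≢w))) a≢w b≢w
      λ eq → differ (trans (sym (paint-in nearu? ψ _ na)) (trans eq (paint-in nearu? ψ _ nb)))

    -- If the colours of u and c differ and the cut vertex lies on the side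
    -- of v, then ab separates u from c on the side of u. As u and c are not
    -- adjacent, one of u, c is not an end of ab and becomes the cut vertex.
    split-surgery : Split (Delete E a b) a b → Split (Surgery (Delete E a b) φ c u v) a b
    split-surgery (split w ψ mono a≢w b≢w differ) with u ≟ w | c ≟ w | ψ u Bool.≟ ψ c
    ... | yes u≡w | _       | _      =
      split-surgery-with (λ d _ _ → mono d) (contradiction u≡w) a≢w b≢w differ
    ... | no _    | yes c≡w | _      =
      split-surgery-with (λ d _ _ → mono d) (λ _ → contradiction c≡w) a≢w b≢w differ
    ... | no _    | no _    | yes eq =
      split-surgery-with (λ d _ _ → mono d) (λ _ _ → eq) a≢w b≢w differ
    ... | no u≢w  | no c≢w  | no ψu≢ψc with nearu? w
    -- Impossible: the side of v contains neither `w` nor the edge ab, so together with uv it still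
    -- joins u to c.
    ...   | yes nw = contradiction (trans (mono u-v u≢w (v≢near nw ∘ sym)) v-c) ψu≢ψc
      where
      u-v : Delete E a b u v
      u-v = u~v , [ (λ (_ , v≡b) → v≢near nb (sym v≡b)) , (λ (_ , v≡a) → v≢near na (sym v≡a)) ]

      far-mono : ∀ {x y} → E x y → Nearv x → Nearv y → x ≢ u → y ≢ u → ψ x ≡ ψ y
      far-mono {x} {y} e fx fy _ _ = mono (e , not-ab) (far≢w fx) (far≢w fy)
        where
        far≢w : ∀ {z} → Nearv z → z ≢ w
        far≢w fz refl = c≢w (sym (both-sides nw fz))
        not-ab : ¬ SamePair x y a b
        not-ab (inj₁ (refl , refl)) = irr (subst₂ E (both-sides na fx) (both-sides nb fy) e)
        not-ab (inj₂ (refl , refl)) = irr (subst₂ E (both-sides nb fx) (both-sides na fy) e)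

      v-c : ψ v ≡ ψ c
      v-c = trans (sym (paint-in V.nearu? ψ (ψ c) v-far))
        (trans (2conn u _ (V.extend-original u ψ (ψ c) far-mono (λ _ u≢u → contradiction refl u≢u) (λ _ → refl))
                 (u≢v ∘ sym) (u≢c ∘ sym))
               (paint-in V.nearu? ψ (ψ c) c-near))
    ...   | no ¬nw with (a ≟ u) ⊎-dec (b ≟ u) | (a ≟ c) ⊎-dec (b ≟ c)
    ...     | no ≢u  | _       = split-surgery-with (λ d nx ny _ _ → mono d (≢w nx) (≢w ny))
      (λ u≢u → contradiction refl u≢u) (≢u ∘ inj₁) (≢u ∘ inj₂) differ
      where
      ≢w : ∀ {z} → Nearu z → z ≢ w
      ≢w nz refl = ¬nw nz
    ...     | _      | no ≢c   = split-surgery-with (λ d nx ny _ _ → mono d (≢w nx) (≢w ny))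
      (λ _ c≢c → contradiction refl c≢c) (≢c ∘ inj₁) (≢c ∘ inj₂) differ
      where
      ≢w : ∀ {z} → Nearu z → z ≢ w
      ≢w nz refl = ¬nw nz
    ...     | yes (inj₁ refl) | yes (inj₁ a≡c)  = contradiction a≡c u≢c
    ...     | yes (inj₂ refl) | yes (inj₂ b≡c)  = contradiction b≡c u≢c
    ...     | yes (inj₁ refl) | yes (inj₂ refl) = contradiction e u≁c
    ...     | yes (inj₂ refl) | yes (inj₁ refl) = contradiction (symm e) u≁c

module SurgeryConnectivity {n} {E : Rel n} {φ : Fin n → Bool} {c u v : Fin n}
  (r : Ring E φ c u v) (2conn : NoCutVertex E) (u≁c : ¬ E u c) (v≁c : ¬ E v c) where

  open Ring r
  open RingProperties r
  open RingConnectivity r 2conn u≁c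
  private module V = RingConnectivity (flip-ring r) 2conn v≁c

  surgery-noCutVertex : NoCutVertex (Surgery E φ c u v)
  surgery-noCutVertex w ψ mono {x} {y} x≢w y≢w with hub-colour mono
  ... | k , uk , ck = trans (constant x x≢w) (sym (constant y y≢w))
    where
    τ τ⁻¹ : Fin n → Fin n
    τ   = transpose u v
    τ⁻¹ = transpose v u

    τ-fixes-c : τ c ≡ c
    τ-fixes-c = transpose-other u v (u≢c ∘ sym) (v≢c ∘ sym)

    moved : ∀ {z} → z ≢ τ⁻¹ w → τ z ≢ w
    moved z≢ refl = z≢ (sym (transpose-inverse v u))

    back : ∀ {z} → z ≢ w → τ⁻¹ z ≢ τ⁻¹ w
    back z≢w = z≢w ∘ transpose-injective v u

    far-constant : ∀ {z} → Nearv z → z ≢ τ⁻¹ w → ψ (τ z) ≡ k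
    -- In the flipped ring the side of v is the near one; the colouring and the deleted vertex are
    -- pulled back along the transposition.
    far-constant = V.near-constant {ψ = ψ ∘ τ}
      (λ s x≢ y≢ → mono (flip-surgery u≢c v≢c s) (moved x≢) (moved y≢))
      (λ v≢ → trans (cong ψ (transpose-r u v)) (uk (subst (_≢ w) (transpose-r u v) (moved v≢))))
      (λ c≢ → trans (cong ψ τ-fixes-c) (ck (subst (_≢ w) τ-fixes-c (moved c≢))))

    constant : ∀ z → z ≢ w → ψ z ≡ k
    constant z z≢w with side z
    ... | inj₁ nz = near-constant mono uk ck nz z≢w
    ... | inj₂ fz with z ≟ v
    ...   | no z≢v = trans (cong ψ (sym z-fixed)) (far-constant fz (subst (_≢ τ⁻¹ w) τ⁻¹z≡z (back z≢w)))
      where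
      z-fixed : τ z ≡ z
      z-fixed = transpose-other u v (u≢far fz) z≢v
      τ⁻¹z≡z : τ⁻¹ z ≡ z
      τ⁻¹z≡z = transpose-other v u z≢v (u≢far fz)
    -- The transposition sends no vertex of the far side to v, since it sends v itself to u. The new
    -- vertex v takes its colour from c, or from u if c is deleted.
    ...   | yes refl with c ≟ w
    ...     | no c≢w = trans (mono (vc (inj₁ (refl , refl))) z≢w c≢w) (ck c≢w)
    ...     | yes refl = trans (sym (mono (uv (inj₁ (refl , refl))) u≢c z≢w)) (uk u≢c)

-- Connectivity

Adj : ∀ {n} → Graph n → Rel n
Adj G x y = ∃ λ i → Joins (lookup G i) x y

joins-sym : ∀ {n} {e : Edge n} {x y} → Joins e x y → Joins e y x
joins-sym (inj₁ p) = inj₂ p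
joins-sym (inj₂ p) = inj₁ p

joins-irr : ∀ {n} {e : Edge n} {x} → ¬ Joins e x x
joins-irr {e = e} (inj₁ (p , q)) = no-loop e (trans p (sym q))
joins-irr {e = e} (inj₂ (p , q)) = no-loop e (trans p (sym q))

joins-unique : ∀ {n} {e : Edge n} {x y a b} → Joins e x y → Joins e a b → SamePair x y a b
joins-unique (inj₁ (refl , refl)) (inj₁ (refl , refl)) = inj₁ (refl , refl)
joins-unique (inj₁ (refl , refl)) (inj₂ (refl , refl)) = inj₂ (refl , refl)
joins-unique (inj₂ (refl , refl)) (inj₁ (refl , refl)) = inj₂ (refl , refl)
joins-unique (inj₂ (refl , refl)) (inj₂ (refl , refl)) = inj₁ (refl , refl)

joins-resp : ∀ {n} {e : Edge n} {x y a b} → SamePair x y a b → Joins e a b → Joins e x y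
joins-resp (inj₁ (refl , refl)) j = j
joins-resp {e = e} (inj₂ (refl , refl)) j = joins-sym {e = e} j

adj-sym : ∀ {n} {G : Graph n} {x y} → Adj G x y → Adj G y x
adj-sym {G = G} (i , j) = i , joins-sym {e = lookup G i} j

adj-irr : ∀ {n} {G : Graph n} {x} → ¬ Adj G x x
adj-irr {G = G} (i , j) = joins-irr {e = lookup G i} j

adj? : ∀ {n} (G : Graph n) x y → Dec (Adj G x y)
adj? G x y = any? λ i → ((source (lookup G i) ≟ x) ×-dec (target (lookup G i) ≟ y))
                   ⊎-dec ((source (lookup G i) ≟ y) ×-dec (target (lookup G i) ≟ x))

removeAt⁻ : ∀ {A : Set} (xs : List A) i j → ∃ λ k → k ≢ i × lookup xs k ≡ lookup (removeAt xs i) j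
removeAt⁻ (x ∷ xs) zero    j       = suc j , (λ ()) , refl
removeAt⁻ (x ∷ xs) (suc i) zero    = zero , (λ ()) , refl
removeAt⁻ (x ∷ xs) (suc i) (suc j) with removeAt⁻ xs i j
... | k , k≢i , eq = suc k , (λ { refl → k≢i refl }) , eq

removeAt⁺ : ∀ {A : Set} (xs : List A) i k → k ≢ i → ∃ λ j → lookup (removeAt xs i) j ≡ lookup xs k
removeAt⁺ (x ∷ xs) zero    zero    k≢i = contradiction refl k≢i
removeAt⁺ (x ∷ xs) zero    (suc k) k≢i = k , refl
removeAt⁺ (x ∷ xs) (suc i) zero    k≢i = zero , refl
removeAt⁺ (x ∷ xs) (suc i) (suc k) k≢i with removeAt⁺ xs i k (λ { refl → k≢i refl })
... | j , eq = suc j , eq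

-- Pigeonhole: otherwise the position of each vertex in `xs` injects `Fin n` into too few positions.
fresh : ∀ {n} (xs : List (Fin n)) → length xs < n → ∃ λ w → w ∉ xs
fresh {n} xs short with any? (λ w → ¬? (ListDec._∈?_ _≟_ w xs))
... | yes found = found
... | no none   = contradiction (injective⇒≤ index-injective) (ℕ.<⇒≱ short)
  where
  mem : ∀ w → w ∈ xs
  mem w = decidable-stable (ListDec._∈?_ _≟_ w xs) λ w∉ → none (w , w∉)
  index-injective : ∀ {x y} → ListAny.index (mem x) ≡ ListAny.index (mem y) → x ≡ y
  index-injective {x} {y} eq =
    trans (ListAny.lookup-index (mem x)) (trans (cong (lookup xs) eq) (sym (ListAny.lookup-index (mem y))))

∉⇒Allᵛ≢ : ∀ {n m} {x : Fin n} {zs : Vec (Fin n) m} → x ∉ᵛ zs → All (x ≢_) zs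
∉⇒Allᵛ≢ {zs = []}     _   = []
∉⇒Allᵛ≢ {zs = z ∷ zs} x∉ = (x∉ ∘ here) ∷ ∉⇒Allᵛ≢ (x∉ ∘ there)

Avoiding : ∀ {n} → Graph n → Subset n → Rel n
Avoiding G S x y = Σ (Path G x y) λ p → All (Subset._∉ S) (vertices p)

avoiding? : ∀ {n} (G : Graph n) S x y → Dec (Avoiding G S x y)
avoiding? G S x y = search-Path G x y λ p → All.all? (λ w → ¬? (w Subset.∈? S)) (vertices p)

module _ {n} {G : Graph n} {S : Subset n} where

  walk-mono : ∀ {k x y ψ} (w : Walk G k x y) → All (Subset._∉ S) (walkVertices w) →
              Monochromatic (Adj G) (Subset._∉ S) ψ → ψ x ≡ ψ y
  walk-mono stop _ mono = refl
  walk-mono (step e j stop) (x∉ ∷ y∉ ∷ []) mono = mono (e , j) x∉ y∉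
  walk-mono (step e j w@(step _ _ _)) (x∉ ∷ rest@(y∉ ∷ _)) mono =
    trans (mono (e , j) x∉ y∉) (walk-mono w rest mono)

  suffix : ∀ {k x y z} (w : Walk G k x y) → Unique (walkVertices w) →
           All (Subset._∉ S) (walkVertices w) → z ∈ᵛ walkVertices w → Avoiding G S z y
  suffix stop         w!       w∉       (here refl) = path _ stop w! , w∉
  suffix (step e j w) w!       w∉       (here refl) = path _ (step e j w) w! , w∉
  suffix (step e j w) (_ ∷ w!) (_ ∷ w∉) (there z∈)  = suffix w w! w∉ z∈

  prepend : ∀ {x y z} → Adj G x y → x Subset.∉ S → Avoiding G S y z → Avoiding G S x z
  prepend {x} (e , j) x∉ (path k w w! , w∉) with x ∈? walkVertices w
  -- The new start is already on the path, and the loop is cut off.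
  ... | yes x∈ = suffix w w! w∉ x∈
  ... | no x∉w = path _ (step e j w) (∉⇒Allᵛ≢ x∉w ∷ w!) , x∉ ∷ w∉

  -- The colouring by the component of `y` in `G` minus `S`; it turns a failure of
  -- path-connectedness into a colouring.
  reachable : Fin n → Fin n → Bool
  reachable y x = does (avoiding? G S x y)

  reachable-mono : ∀ y → Monochromatic (Adj G) (Subset._∉ S) (reachable y)
  reachable-mono y a x∉ z∉ =
    does-⇔ (mk⇔ (prepend (adj-sym {G = G} a) z∉) (prepend a x∉)) (avoiding? G S _ y) (avoiding? G S _ y)

  reachable-self : ∀ {y} → y Subset.∉ S → reachable y y ≡ true
  reachable-self y∉ = dec-true (avoiding? G S _ _) (path 0 stop ([] ∷ []) , y∉ ∷ [])

  reach : ∀ {x y} → reachable y x ≡ true → Avoiding G S x y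
  reach {x} {y} = witness (avoiding? G S x y)
    where
    witness : ∀ {A : Set} (A? : Dec A) → does A? ≡ true → A
    witness (yes a) _ = a

∣p∣≤1⇒≡ : ∀ {n} {S : Subset n} {x y} → ∣ S ∣ ≤ 1 → x Subset.∈ S → y Subset.∈ S → x ≡ y
∣p∣≤1⇒≡ {S = S} {x} {y} small x∈ y∈ with x ≟ y
... | yes eq = eq
... | no x≢y = contradiction (Subset.x∈p⇒∣p-x∣<∣p∣ y∈S-x) (ℕ.≤⇒≯ (ℕ.≤-trans none z≤n))
  where
  y∈S-x : y Subset.∈ S Subset.- x
  y∈S-x = Subset.x∈p∧x≢y⇒x∈p-y y∈ (x≢y ∘ sym)
  none : ∣ S Subset.- x ∣ ≤ 0
  none = s≤s⁻¹ (ℕ.≤-trans (Subset.x∈p⇒∣p-x∣<∣p∣ x∈) small)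

-- A third vertex serves when S is empty.
small-set-in-vertex : ∀ {n} → 3 ≤ n → ∀ {S : Subset n} {x y} → ∣ S ∣ ≤ 1 → x Subset.∉ S → y Subset.∉ S →
  ∃ λ w → x ≢ w × y ≢ w × (∀ {z} → z ≢ w → z Subset.∉ S)
small-set-in-vertex 3≤n {S} {x} {y} small x∉ y∉ with any? (Subset._∈? S)
... | yes (w , w∈) = w , (λ { refl → x∉ w∈ }) , (λ { refl → y∉ w∈ }) , λ z≢w z∈ → z≢w (∣p∣≤1⇒≡ small z∈ w∈)
... | no empty with fresh (x ∷ y ∷ []) 3≤n
...   | w , w∉ = w , (λ { refl → w∉ (here refl) }) , (λ { refl → w∉ (there (here refl)) }) ,
                 λ _ z∈ → empty (_ , z∈)

-- Order at least 4 rules out the one-vertex alternative of `Cut` when at most two vertices are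
-- deleted.
∣∁p∣≢1 : ∀ {n} → 4 ≤ n → ∀ (S : Subset n) → ∣ S ∣ ≤ 2 → ∣ ∁ S ∣ ≢ 1
∣∁p∣≢1 {n} 4≤n S ≤2 eq = ℕ.<⇒≱ 4≤n (subst (_≤ 3) total (ℕ.+-mono-≤ ≤2 (ℕ.≤-reflexive eq)))
  where
  total : ∣ S ∣ + ∣ ∁ S ∣ ≡ n
  total = trans (cong (∣ S ∣ +_) (Subset.∣∁p∣≡n∸∣p∣ S)) (ℕ.m+[n∸m]≡n (Subset.∣p∣≤n S))

connected⇒constant : ∀ {n} {G : Graph n} {w ψ} → ConnectedWithout G ⁅ w ⁆ →
  Monochromatic (Adj G) (_≢ w) ψ → ∀ {x y} → x ≢ w → y ≢ w → ψ x ≡ ψ y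
connected⇒constant conn mono x≢w y≢w
  with path _ p _ , p∉ ← conn _ _ (Subset.x≢y⇒x∉⁅y⁆ x≢w) (Subset.x≢y⇒x∉⁅y⁆ y≢w) =
  walk-mono p p∉ λ a x∉ y∉ → mono a (Subset.x∉⁅y⁆⇒x≢y x∉) (Subset.x∉⁅y⁆⇒x≢y y∉)

small-separator⇒split : ∀ {n} {G : Graph n} → 3 ≤ n → ∀ {S} → ∣ S ∣ ≤ 1 → ¬ ConnectedWithout G S →
  ∃ λ a → ∃ λ b → Split (Adj G) a b
small-separator⇒split {n} {G} 3≤n {S} small disconnected
  with any? (λ x → any? λ y → ¬? (x Subset.∈? S) ×-dec ¬? (y Subset.∈? S) ×-dec ¬? (avoiding? G S x y))
... | no none = contradiction (λ x y x∉ y∉ →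
  decidable-stable (avoiding? G S x y) λ unreachable → none (x , y , x∉ , y∉ , unreachable)) disconnected
... | yes (x , y , x∉ , y∉ , unreachable) with small-set-in-vertex 3≤n small x∉ y∉
...   | w , x≢w , y≢w , outside = x , y , split w (reachable y)
  (λ a x≢w y≢w → reachable-mono y a (outside x≢w) (outside y≢w)) x≢w y≢w
  λ eq → unreachable (reach (trans eq (reachable-self y∉)))

noCutVertex⇒connected : ∀ {n} {G : Graph n} → 3 ≤ n → NoCutVertex (Adj G) →
  ∀ {S} → ∣ S ∣ ≤ 1 → ConnectedWithout G S
noCutVertex⇒connected {G = G} 3≤n 2conn {S} small =
  decidable-stable (connectedWithout? G S) λ disconnected →
    let _ , _ , split w ψ mono x≢w y≢w differ = small-separator⇒split {G = G} 3≤n small disconnected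
    in differ (2conn w ψ mono x≢w y≢w)

module _ {n} .{{_ : NonTrivial n}} (4≤n : 4 ≤ n) {G : Graph n} where

  private
    3≤n : 3 ≤ n
    3≤n = ℕ.≤-trans (ℕ.n≤1+n 3) 4≤n

  connectivity≡2⇒noCutVertex : connectivity G ≡ 2 → NoCutVertex (Adj G)
  connectivity≡2⇒noCutVertex eq w ψ mono = connected⇒constant connected mono
    where
    connected : ConnectedWithout G ⁅ w ⁆
    connected = decidable-stable (connectedWithout? G ⁅ w ⁆) λ disconnected →
      ℕ.<⇒≱ (s≤s (s≤s z≤n)) (subst (_≤ 1) eq
        (proj₂ (proj₂ (connectivity-minimum G)) 1 (⁅ w ⁆ , Subset.∣⁅x⁆∣≡1 w , inj₁ disconnected)))

  -- Having no cut vertex bounds the connectivity only from below; the explicit cut bounds it from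
  -- above.
  noCutVertex⇒connectivity≡2 : NoCutVertex (Adj G) → ∀ {k} → Cut G k → k ≤ 2 → connectivity G ≡ 2
  noCutVertex⇒connectivity≡2 2conn cut k≤2 with connectivity-minimum G
  ... | k , (S , refl , why) , least = ℕ.≤-antisym (ℕ.≤-trans (least _ cut) k≤2) (ℕ.≰⇒> large)
    where
    large : ¬ ∣ S ∣ ≤ 1
    large small = [_,_] {C = λ _ → ⊥} (λ disconnected → disconnected (noCutVertex⇒connected 3≤n 2conn small))
                    (∣∁p∣≢1 4≤n S (ℕ.≤-trans small (ℕ.n≤1+n 1))) why

  connectivity<2⇒split : connectivity G < 2 → ∃ λ a → ∃ λ b → Split (Adj G) a b
  connectivity<2⇒split small with connectivity-minimum G
  ... | k , (S , refl , inj₁ disconnected) , _ = small-separator⇒split 3≤n (s≤s⁻¹ small) disconnected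
  ... | k , (S , refl , inj₂ trivial) , _ = contradiction trivial (∣∁p∣≢1 4≤n S (ℕ.<⇒≤ small))

  split⇒connectivity<2 : ∀ {a b} → Split (Adj G) a b → connectivity G < 2
  split⇒connectivity<2 (split w ψ mono a≢w b≢w differ) =
    s≤s (proj₂ (proj₂ (connectivity-minimum G)) 1
      (⁅ w ⁆ , Subset.∣⁅x⁆∣≡1 w , inj₁ λ connected → differ (connected⇒constant connected mono a≢w b≢w)))

Simple : ∀ {n} → Graph n → Set
Simple G = ∀ {i j x y} → Joins (lookup G i) x y → Joins (lookup G j) x y → i ≡ j

-- As there are no parallel edges, deleting one position is the same as deleting a pair from the
-- adjacency relation, which is how `critical` is phrased.
record Minimal {n} (G : Graph n) : Set where
  field
    2conn       : NoCutVertex (Adj G)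
    no-parallel : Simple G
    critical    : ∀ {i x y} → Joins (lookup G i) x y → Split (Delete (Adj G) x y) x y

module _ {n} .{{_ : NonTrivial n}} (4≤n : 4 ≤ n) {G : Graph n} where

  private
    mono-after : ∀ {i w ψ} → Monochromatic (Adj (deleteEdge G i)) (_≢ w) ψ →
      ∀ {k x y} → k ≢ i → Joins (lookup G k) x y → x ≢ w → y ≢ w → ψ x ≡ ψ y
    mono-after {i} mono {k} k≢i j x≢w y≢w with removeAt⁺ G i k k≢i
    ... | m , eq = mono (m , subst (λ e → Joins e _ _) (sym eq) j) x≢w y≢w

  minimal : MinimallyTwoConnected G → Minimal G
  minimal (conn , minim) = record { 2conn = 2conn ; no-parallel = no-parallel ; critical = critical }
    where
    2conn : NoCutVertex (Adj G)
    2conn = connectivity≡2⇒noCutVertex 4≤n {G} conn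

    no-parallel : Simple G
    no-parallel {i} {j} {x} {y} ji jj with i ≟ j
    ... | yes eq = eq
    ... | no i≢j with connectivity<2⇒split 4≤n {deleteEdge G i} (minim i)
    ...   | _ , _ , split w ψ mono a≢w b≢w differ = contradiction (2conn w ψ all-mono a≢w b≢w) differ
      where
      all-mono : Monochromatic (Adj G) (_≢ w) ψ
      all-mono (k , jk) with k ≟ i
      ... | no k≢i   = mono-after mono k≢i jk
      -- The parallel edge `j` survives the deletion of `i` and keeps the ends in one colour.
      ... | yes refl = mono-after mono (i≢j ∘ sym) (joins-resp {e = lookup G j} (joins-unique {e = lookup G i} jk ji) jj)

    critical : ∀ {i x y} → Joins (lookup G i) x y → Split (Delete (Adj G) x y) x y
    critical {i} {x} {y} ji with connectivity<2⇒split 4≤n {deleteEdge G i} (minim i)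
    ... | _ , _ , split w ψ mono a≢w b≢w differ =
      split w ψ (λ { ((k , jk) , other) → mono-after mono (λ { refl → other (joins-unique {e = lookup G i} jk ji) }) jk })
        (λ x≡w → clash λ { (inj₁ (refl , refl)) x≢w _ → contradiction x≡w x≢w
                         ; (inj₂ (refl , refl)) _ x≢w → contradiction x≡w x≢w })
        (λ y≡w → clash λ { (inj₁ (refl , refl)) _ y≢w → contradiction y≡w y≢w
                         ; (inj₂ (refl , refl)) y≢w _ → contradiction y≡w y≢w })
        (λ eq → clash λ { (inj₁ (refl , refl)) _ _ → eq ; (inj₂ (refl , refl)) _ _ → sym eq })
      where
      -- The split separates some two vertices. If it did not separate the ends x and y of the
      -- deleted edge, because one of them is `w` or they agree in colour, it would be monochromatic
      -- on all of `G`.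
      clash : ¬ (∀ {a b} → SamePair a b x y → a ≢ w → b ≢ w → ψ a ≡ ψ b)
      clash fine = differ (2conn w ψ all-mono a≢w b≢w)
        where
        all-mono : Monochromatic (Adj G) (_≢ w) ψ
        all-mono (k , jk) with k ≟ i
        ... | no k≢i   = mono-after mono k≢i jk
        ... | yes refl = fine (joins-unique {e = lookup G i} jk ji)

  -- The edges other than the i-th are given by position, as G need not be
  -- known to be simple.
  minimally-2-connected : NoCutVertex (Adj G) → ∀ {k} → Cut G k → k ≤ 2 →
    (∀ i → Σ (Fin n) λ w → Σ (Fin n → Bool) λ ψ → Σ (Fin n) λ a → Σ (Fin n) λ b → a ≢ w × b ≢ w × ψ a ≢ ψ b ×
      (∀ {k x y} → k ≢ i → Joins (lookup G k) x y → x ≢ w → y ≢ w → ψ x ≡ ψ y)) →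
    MinimallyTwoConnected G
  minimally-2-connected 2conn cut k≤2 crit = noCutVertex⇒connectivity≡2 4≤n 2conn cut k≤2 , λ i →
    let w , ψ , _ , _ , a≢w , b≢w , differ , mono = crit i in
    split⇒connectivity<2 4≤n {deleteEdge G i} (split w ψ
      (λ { (m , jm) → let k , k≢i , eq = removeAt⁻ G i m in mono k≢i (subst (λ e → Joins e _ _) (sym eq) jm) })
      a≢w b≢w differ)

-- Families of disjoint paths

-- Paths are handled through the lists of their interior vertices.
data Route {n} (E : Rel n) : Fin n → List (Fin n) → Fin n → Set where
  direct : ∀ {x y} → E x y → Route E x [] y
  via    : ∀ {x m p y} → E x m → Route E m p y → Route E x (m ∷ p) y

record IsPath {n} (E : Rel n) (x y : Fin n) (p : List (Fin n)) : Set where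
  constructor isPath
  field
    route  : Route E x p y
    start∉ : x ∉ p
    end∉   : y ∉ p
    unique : List.Unique p

-- In a graph without parallel edges, internally disjoint paths share an edge
-- only if both consist of that edge.
Apart : ∀ {n} → List (Fin n) → List (Fin n) → Set
Apart p q = (∀ {z} → z ∈ p → z ∉ q) × ¬ (p ≡ [] × q ≡ [])

Family : ∀ {n} → Rel n → Fin n → Fin n → List (List (Fin n)) → Set
Family E x y ps = ListAll.All (IsPath E x y) ps × ListPairs.AllPairs Apart ps

∉⇒All≢ : ∀ {A : Set} {x : A} {ys : List A} → x ∉ ys → ListAll.All (x ≢_) ys
∉⇒All≢ {ys = []}     _   = []
∉⇒All≢ {ys = y ∷ ys} x∉ = (x∉ ∘ here) ∷ ∉⇒All≢ (x∉ ∘ there)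

tail-path : ∀ {n} {E : Rel n} {x m p y} → Route E m p y → IsPath E x y (m ∷ p) → m ≢ y × IsPath E m y p
tail-path r (isPath _ _ end∉ (m∉p ∷ p!)) =
  (λ { refl → end∉ (here refl) }) , isPath r (ListAll.All¬⇒¬Any m∉p) (end∉ ∘ there) p!

record Interior {n} (G : Graph n) {k x y} (w : Walk G k x y) : Set where
  field
    interior  : List (Fin n)
    is-path   : IsPath (Adj G) x y interior
    inside    : ∀ {z} → z ∈ interior → z ∈ᵛ walkVertices w
    -- Interior vertices do not tell which edge a one-edge path uses; this recovers it for the
    -- second clause of `Apart`.
    end-edge  : interior ≡ [] → ∃ λ e → e ∈ᵛ walkEdges w × Joins (lookup G e) x y

open Interior

module _ {n} {G : Graph n} where

  start∈ : ∀ {k x y} (w : Walk G k x y) → x ∈ᵛ walkVertices w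
  start∈ stop         = here refl
  start∈ (step _ _ _) = here refl

  end∈ : ∀ {k x y} (w : Walk G k x y) → y ∈ᵛ walkVertices w
  end∈ stop         = here refl
  end∈ (step _ _ w) = there (end∈ w)

  All≢⇒∉ : ∀ {m} {x : Fin n} {zs : Vec (Fin n) m} → All (x ≢_) zs → x ∉ᵛ zs
  All≢⇒∉ (x≢z ∷ _)  (here x≡z) = x≢z x≡z
  All≢⇒∉ (_ ∷ x≢zs) (there x∈) = All≢⇒∉ x≢zs x∈

  walk-interior : ∀ {k x y} (w : Walk G k x y) → Unique (walkVertices w) → x ≢ y → Interior G w
  walk-interior stop _ x≢x = contradiction refl x≢x
  walk-interior {x = x} {y} (step {w = m} e j w) (x∉w ∷ w!) x≢y with m ≟ y
  ... | yes refl = single w w!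
    where
    single : ∀ {k} (w : Walk G k m m) → Unique (walkVertices w) → Interior G (step e j w)
    single stop _ = record
      { interior = [] ; is-path = isPath (direct (e , j)) (λ ()) (λ ()) []
      ; inside = λ () ; end-edge = λ _ → e , here refl , j }
    single (step _ _ w′) (m∉w′ ∷ _) = contradiction (end∈ w′) (All≢⇒∉ m∉w′)
  ... | no m≢y = record
    { interior = m ∷ interior tail
    ; is-path  = isPath (via (e , j) route) x∉p (λ { (here y≡m) → m≢y (sym y≡m) ; (there y∈) → end∉ y∈ })
                        (∉⇒All≢ start∉ ∷ unique)
    ; inside   = λ { (here refl) → there (start∈ w) ; (there z∈) → there (inside tail z∈) }
    ; end-edge = λ () }
    where
    tail : Interior G w
    tail = walk-interior w w! m≢y
    open IsPath (is-path tail)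
    x∉p : x ∉ m ∷ interior tail
    x∉p (here refl) = All≢⇒∉ x∉w (start∈ w)
    x∉p (there x∈)  = All≢⇒∉ x∉w (inside tail x∈)

  path-interior : ∀ {x y} → x ≢ y → (p : Path G x y) → Interior G (walk p)
  path-interior x≢y p = walk-interior (walk p) (simple p) x≢y

  interiors : ∀ {x y k} → x ≢ y → Vec (Path G x y) k → List (List (Fin n))
  interiors x≢y []       = []
  interiors x≢y (p ∷ ps) = interior (path-interior x≢y p) ∷ interiors x≢y ps

  length-interiors : ∀ {x y k} (x≢y : x ≢ y) (ps : Vec (Path G x y) k) → length (interiors x≢y ps) ≡ k
  length-interiors x≢y []       = refl
  length-interiors x≢y (p ∷ ps) = cong suc (length-interiors x≢y ps)

  interiors-family : Simple G → ∀ {x y k} (x≢y : x ≢ y) (ps : Vec (Path G x y) k) →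
    AllPairs InternallyDisjoint ps → Family (Adj G) x y (interiors x≢y ps)
  interiors-family no-parallel x≢y [] [] = [] , []
  interiors-family no-parallel {x} {y} x≢y (p ∷ ps) (p-ps ∷ ps!)
    with interiors-family no-parallel x≢y ps ps!
  ... | paths , apart = is-path (path-interior x≢y p) ∷ paths , all-apart ps p-ps ∷ apart
    where
    apart-from-p : ∀ q → InternallyDisjoint p q →
                   Apart (interior (path-interior x≢y p)) (interior (path-interior x≢y q))
    apart-from-p q (edges-disjoint , meet) = no-common , not-both
      where
      P : Interior G (walk p)
      P = path-interior x≢y p
      Q : Interior G (walk q)
      Q = path-interior x≢y q
      open IsPath (is-path P)
      no-common : ∀ {z} → z ∈ interior P → z ∉ interior Q
      no-common z∈p z∈q with meet _ (inside P z∈p) (inside Q z∈q)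
      ... | inj₁ refl = start∉ z∈p
      ... | inj₂ refl = end∉ z∈p
      not-both : ¬ (interior P ≡ [] × interior Q ≡ [])
      not-both (p≡[] , q≡[]) with end-edge P p≡[] | end-edge Q q≡[]
      ... | e , e∈p , je | f , f∈q , jf =
        edges-disjoint e e∈p (subst (_∈ᵛ edges q) (sym (no-parallel je jf)) f∈q)
    all-apart : ∀ {m} (qs : Vec (Path G x y) m) → All (InternallyDisjoint p) qs →
                ListAll.All (Apart (interior (path-interior x≢y p))) (interiors x≢y qs)
    all-apart []       []         = []
    all-apart (q ∷ qs) (d ∷ ds) = apart-from-p q d ∷ all-apart qs ds

  routeWalk : ∀ {x p y} → Route (Adj G) x p y → Walk G (suc (length p)) x y
  routeWalk (direct (e , j)) = step e j stop
  routeWalk (via (e , j) r)  = step e j (routeWalk r)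

  routeWalk-vertices : ∀ {x p y} (r : Route (Adj G) x p y) {z} → z ∈ᵛ walkVertices (routeWalk r) →
                       z ≡ x ⊎ z ∈ p ⊎ z ≡ y
  routeWalk-vertices (direct _) (here z≡x)         = inj₁ z≡x
  routeWalk-vertices (direct _) (there (here z≡y)) = inj₂ (inj₂ z≡y)
  routeWalk-vertices (via _ r)  (here z≡x)         = inj₁ z≡x
  routeWalk-vertices (via _ r)  (there z∈) with routeWalk-vertices r z∈
  ... | inj₁ z≡m        = inj₂ (inj₁ (here z≡m))
  ... | inj₂ (inj₁ z∈p) = inj₂ (inj₁ (there z∈p))
  ... | inj₂ (inj₂ z≡y) = inj₂ (inj₂ z≡y)

  start∉-rest : ∀ {x m p y} (r : Route (Adj G) m p y) → x ∉ m ∷ p → x ≢ y → x ∉ᵛ walkVertices (routeWalk r)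
  start∉-rest r x∉ x≢y x∈ with routeWalk-vertices r x∈
  ... | inj₁ x≡m        = x∉ (here x≡m)
  ... | inj₂ (inj₁ x∈p) = x∉ (there x∈p)
  ... | inj₂ (inj₂ x≡y) = x≢y x≡y

  routeWalk-unique : ∀ {x p y} (r : Route (Adj G) x p y) → IsPath (Adj G) x y p → x ≢ y →
                     Unique (walkVertices (routeWalk r))
  routeWalk-unique (direct _) _ x≢y = (x≢y ∷ []) ∷ [] ∷ []
  routeWalk-unique (via a r)  P x≢y with tail-path r P
  ... | m≢y , P′ = ∉⇒Allᵛ≢ (start∉-rest r (IsPath.start∉ P) x≢y) ∷ routeWalk-unique r P′ m≢y

  edge-ends : ∀ {k x y} (w : Walk G k x y) {e} → e ∈ᵛ walkEdges w →
    ∃ λ a → ∃ λ b → Joins (lookup G e) a b × a ∈ᵛ walkVertices w × b ∈ᵛ walkVertices w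
  edge-ends (step e j w) (here refl) = _ , _ , j , here refl , there (start∈ w)
  edge-ends (step e j w) (there e∈) with edge-ends w e∈
  ... | a , b , je , a∈ , b∈ = a , b , je , there a∈ , there b∈

  -- The vertex x occurs only at the start, so only the first edge can join x to y, and then the
  -- path is over.
  joining-edge⇒[] : ∀ {x p y} (r : Route (Adj G) x p y) → IsPath (Adj G) x y p → x ≢ y →
    ∀ {e} → e ∈ᵛ walkEdges (routeWalk r) → Joins (lookup G e) x y → p ≡ []
  joining-edge⇒[] (direct _) _ _ _ _ = refl
  joining-edge⇒[] (via (e , j) r) P x≢y (here refl) jxy with joins-unique {e = lookup G e} j jxy
  ... | inj₁ (_ , refl) = contradiction (here refl) (IsPath.end∉ P)
  ... | inj₂ (x≡y , _)  = contradiction x≡y x≢y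
  joining-edge⇒[] {x} (via a r) P x≢y {e} (there e∈) jxy with edge-ends (routeWalk r) e∈
  ... | a , b , je , a∈ , b∈ with joins-unique {e = lookup G e} jxy je
  ...   | inj₁ (refl , _) = contradiction a∈ (start∉-rest r (IsPath.start∉ P) x≢y)
  ...   | inj₂ (refl , _) = contradiction b∈ (start∉-rest r (IsPath.start∉ P) x≢y)

  toPath : ∀ {x p y} → x ≢ y → IsPath (Adj G) x y p → Path G x y
  toPath x≢y P = path _ (routeWalk (IsPath.route P)) (routeWalk-unique _ P x≢y)

  -- The ends of a shared edge are shared vertices, hence x and y. Then both paths consist of that
  -- edge, which `Apart` forbids.
  apart⇒disjoint : ∀ {x p q y} (x≢y : x ≢ y) (P : IsPath (Adj G) x y p) (Q : IsPath (Adj G) x y q) →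
    Apart p q → InternallyDisjoint (toPath x≢y P) (toPath x≢y Q)
  apart⇒disjoint {x} {p} {q} {y} x≢y P Q (no-common , not-both) = edges-disjoint , meet
    where
    meet : ∀ z → z ∈ᵛ vertices (toPath x≢y P) → z ∈ᵛ vertices (toPath x≢y Q) → z ≡ x ⊎ z ≡ y
    meet z z∈p z∈q with routeWalk-vertices (IsPath.route P) z∈p | routeWalk-vertices (IsPath.route Q) z∈q
    ... | inj₁ z≡x        | _               = inj₁ z≡x
    ... | inj₂ (inj₂ z≡y) | _               = inj₂ z≡y
    ... | inj₂ (inj₁ _)   | inj₁ z≡x        = inj₁ z≡x
    ... | inj₂ (inj₁ _)   | inj₂ (inj₂ z≡y) = inj₂ z≡y
    ... | inj₂ (inj₁ z∈)  | inj₂ (inj₁ z∈′) = contradiction z∈′ (no-common z∈)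

    edges-disjoint : ∀ e → e ∈ᵛ edges (toPath x≢y P) → e ∉ᵛ edges (toPath x≢y Q)
    edges-disjoint e e∈p e∈q
      with edge-ends (walk (toPath x≢y P)) e∈p | edge-ends (walk (toPath x≢y Q)) e∈q
    ... | a , b , je , a∈p , b∈p | a′ , b′ , je′ , a′∈q , b′∈q = not-both
      (joining-edge⇒[] (IsPath.route P) P x≢y e∈p joins-xy , joining-edge⇒[] (IsPath.route Q) Q x≢y e∈q joins-xy)
      where
      ab∈q : a ∈ᵛ vertices (toPath x≢y Q) × b ∈ᵛ vertices (toPath x≢y Q)
      ab∈q with joins-unique {e = lookup G e} je je′
      ... | inj₁ (refl , refl) = a′∈q , b′∈q
      ... | inj₂ (refl , refl) = b′∈q , a′∈q
      joins-xy : Joins (lookup G e) x y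
      joins-xy with meet a a∈p (proj₁ ab∈q) | meet b b∈p (proj₂ ab∈q)
      ... | inj₁ refl | inj₂ refl = je
      ... | inj₂ refl | inj₁ refl = joins-sym {e = lookup G e} je
      ... | inj₁ refl | inj₁ refl = contradiction je (joins-irr {e = lookup G e})
      ... | inj₂ refl | inj₂ refl = contradiction je (joins-irr {e = lookup G e})

  family⇒paths : ∀ {x y ps} → x ≢ y → Family (Adj G) x y ps → DisjointPaths G x y (length ps)
  family⇒paths {x} {y} x≢y (Ps , apart) = toPaths Ps , all-disjoint Ps apart
    where
    toPaths : ∀ {qs} → ListAll.All (IsPath (Adj G) x y) qs → Vec (Path G x y) (length qs)
    toPaths []       = []
    toPaths (Q ∷ Qs) = toPath x≢y Q ∷ toPaths Qs
    disjoint : ∀ {p qs} {P : IsPath (Adj G) x y p} (Qs : ListAll.All (IsPath (Adj G) x y) qs) →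
      ListAll.All (Apart p) qs → All (InternallyDisjoint (toPath x≢y P)) (toPaths Qs)
    disjoint []       []       = []
    disjoint {P = P} (Q ∷ Qs) (d ∷ ds) = apart⇒disjoint x≢y P Q d ∷ disjoint {P = P} Qs ds
    all-disjoint : ∀ {qs} (Qs : ListAll.All (IsPath (Adj G) x y) qs) →
      ListPairs.AllPairs Apart qs → AllPairs InternallyDisjoint (toPaths Qs)
    all-disjoint []       []         = []
    all-disjoint (Q ∷ Qs) (d ∷ ds) = disjoint {P = Q} Qs d ∷ all-disjoint Qs ds

  κ-family : Simple G → ∀ {x y} (x≢y : x ≢ y) → ∃ λ ps → Family (Adj G) x y ps × length ps ≡ κ G x≢y
  κ-family no-parallel x≢y with κ-maximum G x≢y
  ... | k , (ps , ps!) , _ = interiors x≢y ps , interiors-family no-parallel x≢y ps ps! , length-interiors x≢y ps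

  family≤κ : ∀ {x y ps} (x≢y : x ≢ y) → Family (Adj G) x y ps → length ps ≤ κ G x≢y
  family≤κ x≢y F = proj₂ (proj₂ (κ-maximum G x≢y)) _ (family⇒paths x≢y F)

module _ {n} {E : Rel n} (E-sym : ∀ {x y} → E x y → E y x) where

  -- The part already reversed is a function awaiting the edge that enters it, since the vertex
  -- where this edge starts is known only when the next vertex is read.
  route-reverseAcc : ∀ {x m acc p y} → (∀ {z} → E z m → Route E z acc x) → Route E m p y →
                     Route E y (reverseAcc acc p) x
  route-reverseAcc F (direct e) = F (E-sym e)
  route-reverseAcc F (via e r)  = route-reverseAcc (λ e′ → via e′ (F (E-sym e))) r

  reverse-path : ∀ {x y p} → IsPath E x y p → IsPath E y x (reverse p)
  reverse-path {p = p} (isPath r x∉ y∉ p!) = isPath (route-reverseAcc direct r)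
    (y∉ ∘ ListAny.reverse⁻) (x∉ ∘ ListAny.reverse⁻)
    (Permutation.Unique-resp-↭ (setoid _) (↭⇒↭ₛ (↭-sym (↭-reverse p))) p!)

  reverse-apart : ∀ {p q : List (Fin n)} → Apart p q → Apart (reverse p) (reverse q)
  reverse-apart (no-common , not-both) =
    (λ z∈p z∈q → no-common (ListAny.reverse⁻ z∈p) (ListAny.reverse⁻ z∈q)) ,
    λ (p≡ , q≡) → not-both (List.reverse-injective p≡ , List.reverse-injective q≡)

  reverse-family : ∀ {x y ps} → Family E x y ps → Family E y x (List.map reverse ps)
  reverse-family (paths , apart) =
    ListAll.map⁺ (ListAll.map reverse-path paths) , map-apart apart
    where
    map-apart : ∀ {ps} → ListPairs.AllPairs Apart ps → ListPairs.AllPairs Apart (List.map reverse ps)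
    map-apart []       = []
    map-apart (a ∷ as) = ListAll.map⁺ (ListAll.map reverse-apart a) ∷ map-apart as

-- pairConnectivity is supported on the pairs u < v.
conn : ∀ {n} → Graph n → Fin n → Fin n → ℕ
conn G x y = pairConnectivity G x y + pairConnectivity G y x

module _ {n} {G : Graph n} where

  pairConnectivity-< : ∀ {x y} → x Fin.< y → ∃ λ x≢y → pairConnectivity G x y ≡ κ G {x} {y} x≢y
  pairConnectivity-< {x} {y} x<y with x Fin.<? y
  ... | yes x<y′ = _ , refl
  ... | no x≮y   = contradiction x<y x≮y

  pairConnectivity-≮ : ∀ {x y} → ¬ x Fin.< y → pairConnectivity G x y ≡ 0
  pairConnectivity-≮ {x} {y} x≮y with x Fin.<? y
  ... | yes x<y = contradiction x<y x≮y
  ... | no _    = refl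

  conn-sym : ∀ x y → conn G x y ≡ conn G y x
  conn-sym x y = ℕ.+-comm (pairConnectivity G x y) _

  conn-self : ∀ x → conn G x x ≡ 0
  conn-self x rewrite pairConnectivity-≮ {x} {x} (ℕ.<-irrefl refl) = refl

  conn-κ : ∀ {x y} → x ≢ y →
    (∃ λ x≢y → conn G x y ≡ κ G {x} {y} x≢y) ⊎ (∃ λ y≢x → conn G x y ≡ κ G {y} {x} y≢x)
  conn-κ {x} {y} x≢y with Fin.<-cmp x y
  ... | tri≈ _ x≡y _ = contradiction x≡y x≢y
  ... | tri< x<y _ y≮x with x≢y′ , eq ← pairConnectivity-< x<y = inj₁ (x≢y′ ,
    trans (cong₂ _+_ eq (pairConnectivity-≮ y≮x)) (ℕ.+-identityʳ _))
  ... | tri> x≮y _ y<x with y≢x , eq ← pairConnectivity-< y<x = inj₂ (y≢x ,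
    cong₂ _+_ (pairConnectivity-≮ x≮y) eq)

  conn-family : Simple G → ∀ {x y} → x ≢ y → ∃ λ ps → Family (Adj G) x y ps × length ps ≡ conn G x y
  conn-family no-parallel x≢y with conn-κ x≢y
  ... | inj₁ (p , eq) with ps , F , len ← κ-family {G = G} no-parallel p = ps , F , trans len (sym eq)
  ... | inj₂ (p , eq) with ps , F , len ← κ-family {G = G} no-parallel p =
    List.map reverse ps , reverse-family (adj-sym {G = G}) F ,
    trans (List.length-map reverse ps) (trans len (sym eq))

  family≤conn : ∀ {x y ps} → x ≢ y → Family (Adj G) x y ps → length ps ≤ conn G x y
  family≤conn {ps = ps} x≢y F with conn-κ x≢y
  ... | inj₁ (p , eq) = subst (length ps ≤_) (sym eq) (family≤κ {G = G} p F)
  ... | inj₂ (p , eq) = subst (_≤ _) (List.length-map reverse ps)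
    (subst (_ ≤_) (sym eq) (family≤κ {G = G} p (reverse-family (adj-sym {G = G}) F)))

-- Paths after the surgery

map-family : ∀ {n} {E F : Rel n} {x y x′ y′} (g : List (Fin n) → List (Fin n)) →
  (∀ {p} → IsPath E x y p → IsPath F x′ y′ (g p)) →
  (∀ {p q} → IsPath E x y p → IsPath E x y q → Apart p q → Apart (g p) (g q)) →
  ∀ {ps} → Family E x y ps → Family F x′ y′ (map g ps)
map-family g paths apart ([] , []) = [] , []
map-family g paths apart (P ∷ Ps , a ∷ as) with map-family g paths apart (Ps , as)
... | Ps′ , as′ = paths P ∷ Ps′ , apart-from Ps a ∷ as′
  where
  apart-from : ∀ {qs} → ListAll.All (IsPath _ _ _) qs → ListAll.All (Apart _) qs →
               ListAll.All (Apart _) (map g qs)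
  apart-from []       []       = []
  apart-from (Q ∷ Qs) (a ∷ as) = apart P Q a ∷ apart-from Qs as

-- Vertices outside K are left out of a path: N contains the vertices of K
-- with a neighbour outside K, and these are pairwise adjacent in F.
module Shortcut {n} {E F : Rel n} {K N : Fin n → Set} (K? : ∀ z → Dec (K z))
  (keep  : ∀ {x y} → K x → K y → E x y → F x y)
  (exit  : ∀ {x y} → K x → ¬ K y → E x y → N x)
  (enter : ∀ {x y} → ¬ K x → K y → E x y → N y)
  (join  : ∀ {x y} → N x → N y → x ≢ y → F x y) where

  mutual
    shortcut-route : ∀ {x p y} → Route E x p y → IsPath E x y p → x ≢ y → K x → K y → Route F x (filter K? p) y
    shortcut-route (direct e) P x≢y Kx Ky = direct (keep Kx Ky e)
    shortcut-route (via {m = m} e r) P x≢y Kx Ky with K? m | tail-path r P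
    ... | yes Km | m≢y , P′ = via (keep Kx Km e) (shortcut-route r P′ m≢y Km Ky)
    ... | no ¬Km | _ , P′   = shortcut-gap r P′ (exit Kx ¬Km e) ¬Km (IsPath.start∉ P ∘ there) x≢y Ky

    -- Here `x` is the last kept vertex and `m` lies in the gap after it. The gap ends at another
    -- vertex of `N`, and one edge of `F` bridges it.
    shortcut-gap : ∀ {x m p y} → Route E m p y → IsPath E m y p → N x → ¬ K m → x ∉ p → x ≢ y → K y →
                   Route F x (filter K? p) y
    shortcut-gap (direct e) P Nx ¬Km x∉ x≢y Ky = direct (join Nx (enter ¬Km Ky e) x≢y)
    shortcut-gap (via {m = m} e r) P Nx ¬Km x∉ x≢y Ky with K? m | tail-path r P
    ... | yes Km | m≢y , P′ = via (join Nx (enter ¬Km Km e) (x∉ ∘ here)) (shortcut-route r P′ m≢y Km Ky)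
    ... | no ¬Km′ | _ , P′ = shortcut-gap r P′ Nx ¬Km′ (x∉ ∘ there) x≢y Ky

  all-dropped : ∀ {m p y} → Route E m p y → ¬ K m → K y → filter K? p ≡ [] → N y
  all-dropped (direct e) ¬Km Ky _ = enter ¬Km Ky e
  all-dropped (via {m = m} e r) ¬Km Ky eq with K? m
  all-dropped (via e r) ¬Km Ky ()  | yes _
  all-dropped (via e r) ¬Km Ky eq  | no ¬Km′ = all-dropped r ¬Km′ Ky eq

  -- A path whose interior is nonempty and dropped entirely has both ends in `N`. Excluding this
  -- prevents two disjoint paths from collapsing to the same edge.
  shortcut-[] : ∀ {x p y} → Route E x p y → K x → K y → ¬ (N x × N y) → filter K? p ≡ [] → p ≡ []
  shortcut-[] (direct e) Kx Ky ¬N _ = refl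
  shortcut-[] (via {m = m} e r) Kx Ky ¬N eq with K? m
  shortcut-[] (via e r) Kx Ky ¬N () | yes _
  shortcut-[] (via e r) Kx Ky ¬N eq | no ¬Km = contradiction (exit Kx ¬Km e , all-dropped r ¬Km Ky eq) ¬N

  shortcut-family : ∀ {x y ps} → x ≢ y → K x → K y → ¬ (N x × N y) → Family E x y ps →
                    Family F x y (map (filter K?) ps)
  shortcut-family x≢y Kx Ky ¬N = map-family (filter K?)
    (λ P → isPath (shortcut-route (IsPath.route P) P x≢y Kx Ky) (IsPath.start∉ P ∘ proj₁ ∘ ∈-filter⁻ K?)
                  (IsPath.end∉ P ∘ proj₁ ∘ ∈-filter⁻ K?) (ListUnique.filter⁺ K? (IsPath.unique P)))
    λ P Q (no-common , not-both) →
      (λ z∈p z∈q → no-common (proj₁ (∈-filter⁻ K? z∈p)) (proj₁ (∈-filter⁻ K? z∈q))) ,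
      λ (p≡ , q≡) → not-both (shortcut-[] (IsPath.route P) Kx Ky ¬N p≡ , shortcut-[] (IsPath.route Q) Kx Ky ¬N q≡)

map-[] : ∀ {A B : Set} {f : A → B} xs → map f xs ≡ [] → xs ≡ []
map-[] [] _ = refl

module _ {n} {E F : Rel n} {f : Fin n → Fin n} (f-inj : ∀ {x y} → f x ≡ f y → x ≡ y)
  (hom : ∀ {x y} → E x y → F (f x) (f y)) where

  image-route : ∀ {x p y} → Route E x p y → Route F (f x) (map f p) (f y)
  image-route (direct e) = direct (hom e)
  image-route (via e r)  = via (hom e) (image-route r)

  map-∉ : ∀ {x p} → x ∉ p → f x ∉ map f p
  map-∉ x∉ fx∈ with ∈-map⁻ f fx∈
  ... | z , z∈ , eq with refl ← f-inj eq = x∉ z∈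

  image-path : ∀ {x y p} → IsPath E x y p → IsPath F (f x) (f y) (map f p)
  image-path (isPath r x∉ y∉ p!) = isPath (image-route r) (map-∉ x∉) (map-∉ y∉) (ListUnique.map⁺ f-inj p!)

  image-apart : ∀ {p q} → Apart p q → Apart (map f p) (map f q)
  image-apart {p} {q} (no-common , not-both) = no-common′ , λ (p≡ , q≡) → not-both (map-[] p p≡ , map-[] q q≡)
    where
    no-common′ : ∀ {z} → z ∈ map f p → z ∉ map f q
    no-common′ z∈p z∈q with ∈-map⁻ f z∈p | ∈-map⁻ f z∈q
    ... | a , a∈ , refl | b , b∈ , eq with refl ← f-inj eq = no-common a∈ b∈

  image-family : ∀ {x y ps} → Family E x y ps → Family F (f x) (f y) (map (map f) ps)
  image-family = map-family (map f) image-path (λ _ _ → image-apart)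

module _ {n} (z : Fin n) where

  z∉? : ∀ p → Dec (z ∉ p)
  z∉? p = ¬? (ListDec._∈?_ _≟_ z p)

  -- At most one of several disjoint paths passes through `z`.
  length-avoiding : ∀ {ps} → ListPairs.AllPairs Apart ps → length ps ≤ suc (length (filter z∉? ps))
  length-avoiding [] = z≤n
  length-avoiding {p ∷ ps} (a ∷ as) with ListDec._∈?_ _≟_ z p
  ... | yes z∈p = s≤s (ℕ.≤-reflexive (sym (cong length
    (List.filter-all z∉? (ListAll.map (λ (no-common , _) → no-common z∈p) a)))))
  ... | no z∉p = s≤s (length-avoiding as)

  avoiding-family : ∀ {E : Rel n} {x y ps} → Family E x y ps → Family E x y (filter z∉? ps)
  avoiding-family (paths , apart) = ListAll.filter⁺ z∉? paths , ListPairs.filter⁺ z∉? apart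

module SurgeryPaths {n} {E : Rel n} {φ : Fin n → Bool} {c u v : Fin n}
  (r : Ring E φ c u v) (u≁c : ¬ E u c) (v≁c : ¬ E v c) where

  open Ring r
  open RingProperties r

  private
    S : Rel n
    S = Surgery E φ c u v

  Kept : Fin n → Set
  Kept z = Nearu z ⊎ z ≡ v

  -- The excursions of a path into the rest of the other side run between v and c, and the new edge
  -- vc replaces them. The pair {v, c} is excluded because several of its paths could collapse to
  -- that edge.
  near-family : ∀ {x y ps} → x ≢ y → Kept x → Kept y → ¬ SamePair x y v c → Family E x y ps →
                ∃ λ qs → Family S x y qs × length qs ≡ length ps
  near-family {x} {y} {ps} x≢y Kx Ky not-vc F =
    _ , shortcut-family x≢y Kx Ky not-N F , List.length-map _ ps
    where
    kept? : ∀ z → Dec (Kept z)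
    kept? z = nearu? z ⊎-dec (z ≟ v)
    N : Fin n → Set
    N z = z ≡ v ⊎ z ≡ c
    keep : ∀ {x y} → Kept x → Kept y → E x y → S x y
    keep (inj₁ nx)  (inj₁ ny)  e = near e nx ny
    keep (inj₂ refl) (inj₂ refl) e = contradiction e irr
    keep (inj₂ refl) (inj₁ ny) e with classify e
    ... | inj₁ (nv , _)           = contradiction refl (v≢near nv)
    ... | inj₂ (inj₁ (_ , fy)) with refl ← both-sides ny fy = contradiction e v≁c
    ... | inj₂ (inj₂ same)        = uv same
    keep (inj₁ nx) (inj₂ refl) e with classify e
    ... | inj₁ (_ , nv)           = contradiction refl (v≢near nv)
    ... | inj₂ (inj₁ (fx , _)) with refl ← both-sides nx fx = contradiction (symm e) v≁c
    ... | inj₂ (inj₂ same)        = uv same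
    exit : ∀ {x y} → Kept x → ¬ Kept y → E x y → N x
    exit (inj₂ x≡v) _ _ = inj₁ x≡v
    exit (inj₁ nx) ¬Ky e with classify e
    ... | inj₁ (_ , ny)                   = contradiction (inj₁ ny) ¬Ky
    ... | inj₂ (inj₁ (fx , _))            = inj₂ (both-sides nx fx)
    ... | inj₂ (inj₂ (inj₁ (_ , y≡v)))    = contradiction (inj₂ y≡v) ¬Ky
    ... | inj₂ (inj₂ (inj₂ (_ , refl)))   = contradiction (inj₁ u-near) ¬Ky
    join : ∀ {x y} → N x → N y → x ≢ y → S x y
    join (inj₁ refl) (inj₁ refl) x≢x = contradiction refl x≢x
    join (inj₂ refl) (inj₂ refl) x≢x = contradiction refl x≢x
    join (inj₁ refl) (inj₂ refl) _   = vc (inj₁ (refl , refl))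
    join (inj₂ refl) (inj₁ refl) _   = vc (inj₂ (refl , refl))
    not-N : ¬ (N x × N y)
    not-N (inj₁ refl , inj₁ refl) = x≢y refl
    not-N (inj₂ refl , inj₂ refl) = x≢y refl
    not-N (inj₁ x≡v , inj₂ y≡c) = not-vc (inj₁ (x≡v , y≡c))
    not-N (inj₂ x≡c , inj₁ y≡v) = not-vc (inj₂ (x≡c , y≡v))
    open Shortcut {E = E} {F = S} {N = N} kept? keep exit (λ ¬Kx Ky e → exit Ky ¬Kx (symm e)) join

  -- Away from c, the only way to leave the side of u is through v.
  stay : ∀ {x p y} → Route E x p y → Nearu x → x ≢ c → c ∉ p → v ∉ p → y ≢ v →
         Route S x p y × ListAll.All Nearu p
  stay (direct e) nx x≢c c∉ v∉ y≢v with classify e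
  ... | inj₁ (_ , ny)                  = direct (near e nx ny) , []
  ... | inj₂ (inj₁ (fx , _))           = contradiction (both-sides nx fx) x≢c
  ... | inj₂ (inj₂ (inj₁ (_ , y≡v)))   = contradiction y≡v y≢v
  ... | inj₂ (inj₂ (inj₂ (x≡v , _)))   = contradiction x≡v (v≢near nx)
  stay (via e r) nx x≢c c∉ v∉ y≢v with classify e
  ... | inj₂ (inj₁ (fx , _))           = contradiction (both-sides nx fx) x≢c
  ... | inj₂ (inj₂ (inj₁ (_ , m≡v)))   = contradiction (here (sym m≡v)) v∉
  ... | inj₂ (inj₂ (inj₂ (x≡v , _)))   = contradiction x≡v (v≢near nx)
  ... | inj₁ (_ , nm) with stay r nm (c∉ ∘ here ∘ sym) (c∉ ∘ there) (v∉ ∘ there) y≢v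
  ...   | r′ , np = via (near e nx nm) r′ , nm ∷ np

  -- Nonemptiness holds because u and c are not adjacent; it is what makes paths from the two sides
  -- `Apart` rather than merely free of common vertices.
  Inner : List (Fin n) → Set
  Inner p = p ≢ [] × ∀ {z} → z ∈ p → Nearu z × z ≢ c × z ≢ u

  inner-path : ∀ {p} → IsPath E u c p → v ∉ p → IsPath S u c p × Inner p
  inner-path P@(isPath r u∉ c∉ p!) v∉ with stay r u-near u≢c c∉ v∉ (v≢c ∘ sym)
  ... | r′ , np = isPath r′ u∉ c∉ p! , not-edge r ,
    λ z∈ → ListAll.lookup np z∈ , (λ { refl → c∉ z∈ }) , (λ { refl → u∉ z∈ })
    where
    not-edge : ∀ {p} → Route E u p c → p ≢ []
    not-edge (direct e) refl = u≁c e

  inner-family : ∀ {ps} → Family E u c ps →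
    let qs = filter (z∉? v) ps in Family S u c qs × ListAll.All Inner qs
  inner-family {ps} F with avoiding-family v F
  ... | paths , apart = (ListAll.map proj₁ inner , apart) , ListAll.map proj₂ inner
    where
    inner : ListAll.All (λ p → IsPath S u c p × Inner p) (filter (z∉? v) ps)
    inner = ListAll.zipWith (λ (P , v∉) → inner-path P v∉) (paths , ListAll.all-filter (z∉? v) ps)

module CrossPaths {n} {E : Rel n} {φ : Fin n → Bool} {c u v : Fin n}
  (r : Ring E φ c u v) (u≁c : ¬ E u c) (v≁c : ¬ E v c) where

  open Ring r
  open RingProperties r
  open SurgeryPaths r u≁c v≁c
  private
    module V = SurgeryPaths (flip-ring r) v≁c u≁c
    S : Rel n
    S = Surgery E φ c u v
    τ : Fin n → Fin n
    τ = transpose u v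

  moved-family : ∀ {x y ps} → Family (Surgery E φ c v u) x y ps → Family S (τ x) (τ y) (map (map τ) ps)
  moved-family = image-family (transpose-injective u v) (flip-surgery u≢c v≢c)

  far-family : ∀ {x y ps} → x ≢ y → Nearv x ⊎ x ≡ u → Nearv y ⊎ y ≡ u → ¬ SamePair x y u c → Family E x y ps →
               ∃ λ qs → Family S (τ x) (τ y) qs × length qs ≡ length ps
  far-family x≢y Kx Ky not-uc F with V.near-family x≢y Kx Ky not-uc F
  ... | qs , F′ , eq = _ , moved-family F′ , trans (List.length-map (map τ) qs) eq

  map-τ-fixed : ∀ {p} → u ∉ p → v ∉ p → map τ p ≡ p
  map-τ-fixed {[]}    _  _  = refl
  map-τ-fixed {z ∷ p} u∉ v∉ = cong₂ _∷_ (transpose-other u v (u∉ ∘ here ∘ sym) (v∉ ∘ here ∘ sym))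
                                        (map-τ-fixed (u∉ ∘ there) (v∉ ∘ there))

  -- These interiors avoid v by definition and u because u is not on that side, so only the start v
  -- of the paths is moved.
  map-τ-inner : ∀ {ps} → ListAll.All V.Inner ps → map (map τ) ps ≡ ps
  map-τ-inner []             = refl
  map-τ-inner ((_ , i) ∷ is) = cong₂ _∷_
    (map-τ-fixed (λ u∈ → u≢far (proj₁ (i u∈)) refl) (λ v∈ → proj₂ (proj₂ (i v∈)) refl)) (map-τ-inner is)

  -- The path crosses uv, and the surgery lets it skip v.
  crossing-path : ∀ {x p y} → Route E x p y → IsPath E x y p → Nearu x → x ≢ c → Nearv y → y ≢ c → y ≢ v → c ∉ p →
    v ∈ p × u ∈ x ∷ p × ∃ λ q → Route S x q y × (∀ {z} → z ∈ q → z ∈ p) × List.Unique q × u ∈ x ∷ q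
  crossing-path (direct e) P nx x≢c fy y≢c y≢v c∉ with classify e
  ... | inj₁ (_ , ny)                = contradiction (both-sides ny fy) y≢c
  ... | inj₂ (inj₁ (fx , _))         = contradiction (both-sides nx fx) x≢c
  ... | inj₂ (inj₂ (inj₁ (_ , y≡v))) = contradiction y≡v y≢v
  ... | inj₂ (inj₂ (inj₂ (x≡v , _))) = contradiction x≡v (v≢near nx)
  crossing-path (via {p = p} {y} e r) P nx x≢c fy y≢c y≢v c∉ with classify e | tail-path r P
  ... | inj₂ (inj₁ (fx , _))         | _ = contradiction (both-sides nx fx) x≢c
  ... | inj₂ (inj₂ (inj₂ (x≡v , _))) | _ = contradiction x≡v (v≢near nx)
  ... | inj₁ (_ , nm) | m≢y , P′ with crossing-path r P′ nm (c∉ ∘ here ∘ sym) fy y≢c y≢v (c∉ ∘ there)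
  ...   | v∈ , u∈ , q , r′ , q⊆p , q! , u∈′ = there v∈ , there u∈ , _ , via (near e nx nm) r′ ,
    (λ { (here eq) → here eq ; (there z∈) → there (q⊆p z∈) }) ,
    ∉⇒All≢ (IsPath.start∉ P′ ∘ q⊆p) ∷ q! , there u∈′
  crossing-path (via {p = p} {y} e r) P nx x≢c fy y≢c y≢v c∉ | inj₂ (inj₂ (inj₁ (refl , refl))) | _ , P′ =
    here refl , here refl , p , skip , there , IsPath.unique P′ , here refl
    where
    u∉p : u ∉ p
    u∉p = IsPath.start∉ P ∘ there
    v∉p : v ∉ p
    v∉p = IsPath.start∉ P′
    skip : Route S u p y
    -- After v the path stays on its side; the transposition moves nothing of it but its start,
    -- which becomes u.
    skip with image-route (transpose-injective u v) (flip-surgery u≢c v≢c)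
                (proj₁ (V.stay r v-far v≢c (c∉ ∘ there) u∉p (u≢far fy)))
    ... | r′ rewrite transpose-r u v | map-τ-fixed u∉p v∉p | transpose-other u v (u≢far fy) y≢v = r′

  private
    kept : ∀ {x y} → E x y → x ≢ u → x ≢ v → y ≢ u → y ≢ v → S x y
    kept e x≢u x≢v y≢u y≢v with classify e
    ... | inj₁ (nx , ny)               = near e nx ny
    ... | inj₂ (inj₁ (fx , fy))        =
      subst₂ S (transpose-other u v x≢u x≢v) (transpose-other u v y≢u y≢v) (far e fx fy)
    ... | inj₂ (inj₂ (inj₁ (x≡u , _))) = contradiction x≡u x≢u
    ... | inj₂ (inj₂ (inj₂ (x≡v , _))) = contradiction x≡v x≢v

  avoiding-route : ∀ {x p y} → Route E x p y → x ≢ u → x ≢ v → y ≢ u → y ≢ v → u ∉ p → v ∉ p → Route S x p y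
  avoiding-route (direct e) x≢u x≢v y≢u y≢v u∉ v∉ = direct (kept e x≢u x≢v y≢u y≢v)
  avoiding-route (via e r)  x≢u x≢v y≢u y≢v u∉ v∉ = via (kept e x≢u x≢v (u∉ ∘ here ∘ sym) (v∉ ∘ here ∘ sym))
    (avoiding-route r (u∉ ∘ here ∘ sym) (v∉ ∘ here ∘ sym) y≢u y≢v (u∉ ∘ there) (v∉ ∘ there))

  module _ {x y} (nx : Nearu x) (x≢c : x ≢ c) (x≢u : x ≢ u) (fy : Nearv y) (y≢c : y ≢ c) (y≢v : y ≢ v) where

    private
      crosses : ∀ {p} → IsPath E x y p → c ∉ p → u ∈ p × v ∈ p
      crosses P c∉ with crossing-path (IsPath.route P) P nx x≢c fy y≢c y≢v c∉
      ... | v∈ , here u≡x  , _ = contradiction (sym u≡x) x≢u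
      ... | v∈ , there u∈ , _ = u∈ , v∈

      -- One of the two paths crosses uv, so the other one avoids u and v.
      pair : ∀ {p q} → IsPath E x y p → c ∉ p → IsPath E x y q → Apart p q →
             ∃ λ p′ → IsPath S x y p′ × IsPath S x y q × Apart p′ q
      pair {p} {q} P c∉ Q (no-common , _)
        with crosses P c∉ | crossing-path (IsPath.route P) P nx x≢c fy y≢c y≢v c∉
      ... | u∈p , v∈p | _ , _ , p′ , r′ , p′⊆p , p′! , u∈ = p′ ,
        isPath r′ (IsPath.start∉ P ∘ p′⊆p) (IsPath.end∉ P ∘ p′⊆p) p′! ,
        isPath (avoiding-route (IsPath.route Q) x≢u (v≢near nx) (u≢far fy) y≢v (no-common u∈p) (no-common v∈p))
               (IsPath.start∉ Q) (IsPath.end∉ Q) (IsPath.unique Q) ,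
        (no-common ∘ p′⊆p) , λ (p′≡[] , _) → nonempty p′≡[] u∈
        where
        nonempty : ∀ {z} → z ≡ [] → u ∈ x ∷ z → ⊥
        nonempty refl (here u≡x) = x≢u (sym u≡x)

      clash : ∀ {p q} → IsPath E x y p → IsPath E x y q → Apart p q → c ∉ p → c ∉ q → ⊥
      clash P Q (no-common , _) c∉p c∉q = no-common (proj₁ (crosses P c∉p)) (proj₁ (crosses Q c∉q))

      apart-sym : ∀ {p q : List (Fin n)} → Apart p q → Apart q p
      apart-sym (no-common , not-both) = (λ z∈q z∈p → no-common z∈p z∈q) , λ (q≡ , p≡) → not-both (p≡ , q≡)

    -- A path avoiding c contains u and v, so there are at most two disjoint paths. A lone path may
    -- run through u, v and c in ways the surgery breaks; any path of the new graph replaces it,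
    -- hence the first hypothesis.
    cross-family : ∀ {ps} → ∃ (IsPath S x y) → Family E x y ps → ∃ λ qs → Family S x y qs × length qs ≡ length ps
    cross-family {[]}              _        _ = [] , ([] , []) , refl
    cross-family {_ ∷ []}          (p , P)  _ = p ∷ [] , (P ∷ [] , [] ∷ []) , refl
    cross-family {p ∷ q ∷ []} _ (P ∷ Q ∷ [] , (a ∷ []) ∷ _) with ListDec._∈?_ _≟_ c p
    ... | no c∉p with pair P c∉p Q a
    ...   | p′ , P′ , Q′ , a′ = p′ ∷ q ∷ [] , (P′ ∷ Q′ ∷ [] , (a′ ∷ []) ∷ [] ∷ []) , refl
    cross-family {p ∷ q ∷ []} _ (P ∷ Q ∷ [] , (a ∷ []) ∷ _) | yes c∈p with pair Q (proj₁ a c∈p) P (apart-sym a)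
    ...   | q′ , Q′ , P′ , a′ = q′ ∷ p ∷ [] , (Q′ ∷ P′ ∷ [] , (a′ ∷ []) ∷ [] ∷ []) , refl
    -- Two of three disjoint paths avoid c, and both would contain u.
    cross-family {p ∷ q ∷ s ∷ _} _ (P ∷ Q ∷ R ∷ _ , (a ∷ b ∷ _) ∷ (d ∷ _) ∷ _)
      with ListDec._∈?_ _≟_ c p | ListDec._∈?_ _≟_ c q
    ... | yes c∈p | _       = contradiction (proj₁ b c∈p) (clash Q R d (proj₁ a c∈p))
    ... | no c∉p  | yes c∈q = contradiction (proj₁ d c∈q) (clash P R b c∉p)
    ... | no c∉p  | no c∉q  = contradiction c∉q (clash P Q a c∉p)

  -- The paths through v among those from u to c, and through u among those
  -- from v to c, are lost; the path u v c is gained.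
  hub-family : ∀ {ps qs} → Family E u c ps → Family E v c qs →
    ∃ λ rs → Family S u c rs × length ps + length qs ≤ suc (length rs)
  hub-family {ps} {qs} Fu@(_ , apart-u) Fv@(_ , apart-v)
    with inner-family Fu | V.inner-family Fv
  ... | (Pu , au) , iu | Gv , iv with moved-family Gv
  ...   | Gv′ rewrite transpose-r u v | transpose-other u v (u≢c ∘ sym) (v≢c ∘ sym) | map-τ-inner iv with Gv′
  ...     | Pv , av = (v ∷ []) ∷ ps′ ++ qs′ ,
    ( uvc ∷ ListAll.++⁺ Pu Pv
    , ListAll.++⁺ (ListAll.map (apart-uvc ∘ near-∌v) iu) (ListAll.map (apart-uvc ∘ far-∌v) iv)
      ∷ ListPairs.++⁺ au av (ListAll.map (λ i → ListAll.map (near-far i) iv) iu) ) ,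
    bound
    where
    ps′ qs′ : List (List (Fin n))
    ps′ = filter (z∉? v) ps
    qs′ = filter (z∉? u) qs

    uvc : IsPath S u c (v ∷ [])
    uvc = isPath (via (uv (inj₁ (refl , refl))) (direct (vc (inj₁ (refl , refl)))))
                 (λ { (here u≡v) → u≢v u≡v }) (λ { (here c≡v) → v≢c (sym c≡v) }) ([] ∷ [])

    near-∌v : ∀ {p} → Inner p → v ∉ p
    near-∌v (_ , inner) v∈ = v≢near (proj₁ (inner v∈)) refl

    far-∌v : ∀ {p} → V.Inner p → v ∉ p
    far-∌v (_ , inner) v∈ = proj₂ (proj₂ (inner v∈)) refl

    apart-uvc : ∀ {p} → v ∉ p → Apart (v ∷ []) p
    apart-uvc v∉ = (λ { (here refl) → v∉ }) , λ ()

    near-far : ∀ {p q} → Inner p → V.Inner q → Apart p q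
    near-far (p≢[] , inner) (_ , inner′) =
      (λ z∈p z∈q → proj₁ (proj₂ (inner z∈p)) (both-sides (proj₁ (inner z∈p)) (proj₁ (inner′ z∈q)))) ,
      (p≢[] ∘ proj₁)

    bound : length ps + length qs ≤ suc (suc (length (ps′ ++ qs′)))
    bound = begin
      length ps + length qs               ≤⟨ ℕ.+-mono-≤ (length-avoiding v apart-u) (length-avoiding u apart-v) ⟩
      suc (length ps′) + suc (length qs′) ≡⟨ cong suc (ℕ.+-suc (length ps′) (length qs′)) ⟩
      suc (suc (length ps′ + length qs′)) ≡⟨ cong (2 +_) (List.length-++ ps′) ⟨
      suc (suc (length (ps′ ++ qs′)))     ∎
      where open ℕ.≤-Reasoning

  spoke-family : ∀ {p} → IsPath E u c p → v ∉ p → Family S v c ([] ∷ (u ∷ p) ∷ [])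
  spoke-family P v∉p with inner-path P v∉p
  ... | isPath r u∉ c∉ p! , _ =
    ( isPath (direct (vc (inj₁ (refl , refl)))) (λ ()) (λ ()) []
    ∷ isPath (via (uv (inj₂ (refl , refl))) r) (λ { (here v≡u) → u≢v (sym v≡u) ; (there v∈) → v∉p v∈ })
             (λ { (here c≡u) → u≢c (sym c≡u) ; (there c∈) → c∉ c∈ }) (∉⇒All≢ u∉ ∷ p!)
    ∷ [] ) , (((λ ()) , λ ()) ∷ []) ∷ [] ∷ []

-- The surgered graph

module _ {A B : Set} (f : A → B) where

  map-index : ∀ xs → Fin (length (map f xs)) → Fin (length xs)
  map-index (x ∷ xs) zero    = zero
  map-index (x ∷ xs) (suc i) = suc (map-index xs i)

  map-index-injective : ∀ xs {i j} → map-index xs i ≡ map-index xs j → i ≡ j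
  map-index-injective (x ∷ xs) {zero}  {zero}  eq = refl
  map-index-injective (x ∷ xs) {suc i} {suc j} eq =
    cong suc (map-index-injective xs (Fin.suc-injective eq))

  map-index-surjective : ∀ xs j → ∃ λ i → map-index xs i ≡ j
  map-index-surjective (x ∷ xs) zero    = zero , refl
  map-index-surjective (x ∷ xs) (suc j) with map-index-surjective xs j
  ... | i , refl = suc i , refl

  lookup-map-index : ∀ xs i → lookup (map f xs) i ≡ f (lookup xs (map-index xs i))
  lookup-map-index (x ∷ xs) zero    = refl
  lookup-map-index (x ∷ xs) (suc i) = lookup-map-index xs i

∣p∪q∣≤∣p∣+∣q∣ : ∀ {n} (p q : Subset n) → ∣ p ∪ q ∣ ≤ ∣ p ∣ + ∣ q ∣
∣p∪q∣≤∣p∣+∣q∣ []            []            = z≤n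
∣p∪q∣≤∣p∣+∣q∣ (true  ∷ p) (false ∷ q) = s≤s (∣p∪q∣≤∣p∣+∣q∣ p q)
∣p∪q∣≤∣p∣+∣q∣ (false ∷ p) (false ∷ q) = ∣p∪q∣≤∣p∣+∣q∣ p q
∣p∪q∣≤∣p∣+∣q∣ (false ∷ p) (true  ∷ q) =
  ℕ.≤-trans (s≤s (∣p∪q∣≤∣p∣+∣q∣ p q)) (ℕ.≤-reflexive (sym (ℕ.+-suc ∣ p ∣ ∣ q ∣)))
∣p∪q∣≤∣p∣+∣q∣ (true  ∷ p) (true  ∷ q) =
  s≤s (ℕ.≤-trans (∣p∪q∣≤∣p∣+∣q∣ p q) (ℕ.+-monoʳ-≤ ∣ p ∣ (ℕ.n≤1+n ∣ q ∣)))

singleton : ∀ {n} → Fin n → Fin n → Bool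
singleton v z = does (z ≟ v)

singleton-self : ∀ {n} (v : Fin n) → singleton v v ≡ true
singleton-self v = dec-true (v ≟ v) refl

singleton-other : ∀ {n} {v z : Fin n} → z ≢ v → singleton v z ≡ false
singleton-other {v = v} {z} = dec-false (z ≟ v)

singleton-differs : ∀ {n} {v z : Fin n} → z ≢ v → singleton v v ≢ singleton v z
singleton-differs {v = v} z≢v eq with () ← trans (sym (singleton-self v)) (trans eq (singleton-other z≢v))

-- The end a of an edge ab becomes u if a = v and b ≢ u.
rename : ∀ {n} (u v a b : Fin n) → Fin n
rename u v a b with a ≟ v | b ≟ u
... | yes _ | no _  = u
... | yes _ | yes _ = a
... | no _  | _     = a

module _ {n} (u v : Fin n) where

  rename-other : ∀ {a b} → a ≢ v → rename u v a b ≡ a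
  rename-other {a} {b} a≢v with a ≟ v | b ≟ u
  ... | yes a≡v | _ = contradiction a≡v a≢v
  ... | no _    | _ = refl

  rename-uv : ∀ {a} → rename u v a u ≡ a
  rename-uv {a} with a ≟ v | u ≟ u
  ... | yes _ | no u≢u = contradiction refl u≢u
  ... | yes _ | yes _  = refl
  ... | no _  | _      = refl

  rename-far : ∀ {b} → b ≢ u → rename u v v b ≡ u
  rename-far {b} b≢u with v ≟ v | b ≟ u
  ... | yes _  | no _    = refl
  ... | yes _  | yes b≡u = contradiction b≡u b≢u
  ... | no v≢v | _       = contradiction refl v≢v

  rename-loopless : u ≢ v → ∀ {a b} → a ≢ b → rename u v a b ≢ rename u v b a
  rename-loopless u≢v {a} {b} a≢b eq with a ≟ v | b ≟ u | b ≟ v | a ≟ u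
  ... | yes refl | _        | yes refl | _        = a≢b refl
  ... | yes refl | yes refl | no _     | _        = a≢b eq
  ... | yes refl | no b≢u   | no _     | _        = b≢u (sym eq)
  ... | no _     | _        | yes refl | yes refl = a≢b eq
  ... | no _     | _        | yes refl | no a≢u   = a≢u eq
  ... | no _     | _        | no _     | _        = a≢b eq

  move : u ≢ v → Edge n → Edge n
  move u≢v e = edge (rename u v (source e) (target e)) (rename u v (target e) (source e))
                    (rename-loopless u≢v (no-loop e))

  move-joins⁺ : ∀ u≢v e {x y} → Joins e x y → Joins (move u≢v e) (rename u v x y) (rename u v y x)
  move-joins⁺ u≢v e (inj₁ (refl , refl)) = inj₁ (refl , refl)
  move-joins⁺ u≢v e (inj₂ (refl , refl)) = inj₂ (refl , refl)

  move-joins⁻ : ∀ u≢v e {x y} → Joins (move u≢v e) x y →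
    ∃ λ x′ → ∃ λ y′ → Joins e x′ y′ × rename u v x′ y′ ≡ x × rename u v y′ x′ ≡ y
  move-joins⁻ u≢v e (inj₁ (p , q)) = source e , target e , inj₁ (refl , refl) , p , q
  move-joins⁻ u≢v e (inj₂ (p , q)) = target e , source e , inj₂ (refl , refl) , q , p

module SurgeryGraph {n} (4≤n : 4 ≤ n) .{{_ : NonTrivial n}} (G : Graph n) (minimalG : Minimal G)
  {φ : Fin n → Bool} {c u v : Fin n} (r : Ring (Adj G) φ c u v)
  (u≁c : ¬ Adj G u c) (v≁c : ¬ Adj G v c) where

  open Minimal minimalG
  open Ring r
  open RingProperties r

  H : Graph n
  H = edge v c v≢c ∷ map (move u v u≢v) G

  origin : Fin (length (map (move u v u≢v) G)) → EdgeOf G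
  origin = map-index (move u v u≢v) G

  -- How the edge x′y′ of G becomes the edge xy of H.
  data Moved (x′ y′ x y : Fin n) : Set where
    near : Nearu x′ → Nearu y′ → x′ ≡ x → y′ ≡ y → Moved x′ y′ x y
    far  : Nearv x′ → Nearv y′ → transpose u v x′ ≡ x → transpose u v y′ ≡ y → Moved x′ y′ x y
    uv   : SamePair x′ y′ u v → x′ ≡ x → y′ ≡ y → Moved x′ y′ x y

  far-rename : ∀ {x y} → Nearv x → Nearv y → rename u v x y ≡ transpose u v x
  far-rename {x} {y} fx fy = go (x ≟ v)
    where
    go : Dec (x ≡ v) → rename u v x y ≡ transpose u v x
    go (yes refl) = trans (rename-far u v (u≢far fy)) (sym (transpose-r u v))
    go (no x≢v)   = trans (rename-other u v x≢v) (sym (transpose-other u v (u≢far fx) x≢v))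

  moved : ∀ {x y} → Adj G x y → Moved x y (rename u v x y) (rename u v y x)
  moved a with classify a
  ... | inj₁ (nx , ny)        = near nx ny (sym (rename-other u v (v≢near nx))) (sym (rename-other u v (v≢near ny)))
  ... | inj₂ (inj₁ (fx , fy)) = far fx fy (sym (far-rename fx fy)) (sym (far-rename fy fx))
  ... | inj₂ (inj₂ (inj₁ (refl , refl))) =
    uv (inj₁ (refl , refl)) (sym (rename-other u v u≢v)) (sym (rename-uv u v))
  ... | inj₂ (inj₂ (inj₂ (refl , refl))) =
    uv (inj₂ (refl , refl)) (sym (rename-uv u v)) (sym (rename-other u v u≢v))

  joins-H⁻ : ∀ i {x y} → Joins (lookup H (suc i)) x y →
    ∃ λ x′ → ∃ λ y′ → Joins (lookup G (origin i)) x′ y′ × Moved x′ y′ x y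
  joins-H⁻ i j with move-joins⁻ u v u≢v (lookup G (origin i)) (subst (λ e → Joins e _ _) (lookup-map-index (move u v u≢v) G i) j)
  ... | x′ , y′ , j′ , refl , refl = x′ , y′ , j′ , moved (origin i , j′)

  joins-H⁺ : ∀ {x y} → Adj G x y → Adj H (rename u v x y) (rename u v y x)
  joins-H⁺ (k , j) with map-index-surjective (move u v u≢v) G k
  ... | i , refl = suc i , subst (λ e → Joins e _ _) (sym (lookup-map-index (move u v u≢v) G i))
                                 (move-joins⁺ u v u≢v (lookup G (origin i)) j)

  new-edge : ∀ {x y} → Joins (lookup H zero) x y → SamePair x y v c
  new-edge (inj₁ (p , q)) = inj₁ (sym p , sym q)
  new-edge (inj₂ (p , q)) = inj₂ (sym q , sym p)

  surgery-moved : ∀ {D : Rel n} {x′ y′ x y} → D x′ y′ → Moved x′ y′ x y → Surgery D φ c u v x y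
  surgery-moved d (near nx ny refl refl)  = near d nx ny
  surgery-moved d (far fx fy refl refl)   = far d fx fy
  surgery-moved d (uv same refl refl)     = uv same

  H⇒surgery : ∀ {x y} → Adj H x y → Surgery (Adj G) φ c u v x y
  H⇒surgery (zero , j)  = vc (new-edge j)
  H⇒surgery (suc i , j) with joins-H⁻ i j
  ... | _ , _ , j′ , m = surgery-moved (origin i , j′) m

  surgery⇒H : ∀ {x y} → Surgery (Adj G) φ c u v x y → Adj H x y
  surgery⇒H (near a nx ny) =
    subst₂ (Adj H) (rename-other u v (v≢near nx)) (rename-other u v (v≢near ny)) (joins-H⁺ a)
  surgery⇒H (far a fx fy) = subst₂ (Adj H) (far-rename fx fy) (far-rename fy fx) (joins-H⁺ a)
  surgery⇒H (uv (inj₁ (refl , refl))) =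
    subst₂ (Adj H) (rename-other u v u≢v) (rename-uv u v) (joins-H⁺ u~v)
  surgery⇒H (uv (inj₂ (refl , refl))) =
    subst₂ (Adj H) (rename-uv u v) (rename-other u v u≢v) (joins-H⁺ (symm u~v))
  surgery⇒H (vc (inj₁ (refl , refl))) = zero , inj₁ (refl , refl)
  surgery⇒H (vc (inj₂ (refl , refl))) = zero , inj₂ (refl , refl)

  H-noCutVertex : NoCutVertex (Adj H)
  H-noCutVertex w ψ mono =
    SurgeryConnectivity.surgery-noCutVertex r 2conn u≁c v≁c w ψ (mono ∘ surgery⇒H)

  transposed≢v : ∀ {x} → Nearv x → transpose u v x ≢ v
  transposed≢v {x} fx eq = u≢far fx (trans (sym (transpose-inverse v u))
    (trans (cong (transpose v u) eq) (transpose-l v u)))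

  not-v : ∀ {x y} → x ≢ v → y ≢ v → singleton v x ≡ singleton v y
  not-v x≢v y≢v = trans (singleton-other x≢v) (sym (singleton-other y≢v))

  -- The hubs are the only neighbours of v, so deleting them isolates v from a fourth vertex.
  H-cut : Cut H ∣ ⁅ u ⁆ ∪ ⁅ c ⁆ ∣
  H-cut with fresh (u ∷ v ∷ c ∷ []) 4≤n
  ... | z , z∉ = S , refl , inj₁ disconnected
    where
    S : Subset n
    S = ⁅ u ⁆ ∪ ⁅ c ⁆

    ∉S : ∀ {x} → x ≢ u → x ≢ c → x Subset.∉ S
    ∉S x≢u x≢c x∈ with Subset.x∈p∪q⁻ ⁅ u ⁆ ⁅ c ⁆ x∈
    ... | inj₁ x∈u = x≢u (Subset.x∈⁅y⁆⇒x≡y u x∈u)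
    ... | inj₂ x∈c = x≢c (Subset.x∈⁅y⁆⇒x≡y c x∈c)

    u∈S : u Subset.∈ S
    u∈S = Subset.x∈p∪q⁺ (inj₁ (Subset.x∈⁅x⁆ u))
    c∈S : c Subset.∈ S
    c∈S = Subset.x∈p∪q⁺ (inj₂ (Subset.x∈⁅x⁆ c))

    mono : Monochromatic (Adj H) (Subset._∉ S) (singleton v)
    mono a x∉ y∉ with H⇒surgery a
    ... | near _ nx ny           = not-v (v≢near nx) (v≢near ny)
    ... | far _ fx fy            = not-v (transposed≢v fx) (transposed≢v fy)
    ... | uv (inj₁ (refl , _))   = contradiction u∈S x∉
    ... | uv (inj₂ (_ , refl))   = contradiction u∈S y∉
    ... | vc (inj₁ (_ , refl))   = contradiction c∈S y∉
    ... | vc (inj₂ (refl , _))   = contradiction c∈S x∉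

    disconnected : ¬ ConnectedWithout H S
    disconnected connected
      with path _ w _ , w∉ ← connected v z (∉S (u≢v ∘ sym) v≢c)
        (∉S (λ z≡u → z∉ (here z≡u)) (λ z≡c → z∉ (there (there (here z≡c))))) =
      singleton-differs (λ z≡v → z∉ (there (here z≡v))) (walk-mono w w∉ mono)

  CriticalAt : EdgeOf H → Set
  CriticalAt i = Σ (Fin n) λ w → Σ (Fin n → Bool) λ ψ → Σ (Fin n) λ a → Σ (Fin n) λ b → a ≢ w × b ≢ w × ψ a ≢ ψ b ×
    (∀ {k x y} → k ≢ i → Joins (lookup H k) x y → x ≢ w → y ≢ w → ψ x ≡ ψ y)

  -- Simplicity of `G` turns a different position in `H` into a different pair of `G`, so simplicity
  -- of `H` does not have to be established.
  critical-from : ∀ i {s t a b} → Joins (lookup G (origin i)) s t →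
    Split (Surgery (Delete (Adj G) s t) φ c u v) a b → CriticalAt (suc i)
  critical-from i {s} {t} j (split w ψ mono a≢w b≢w differ) = w , ψ , _ , _ , a≢w , b≢w , differ , mono′
    where
    mono′ : ∀ {k x y} → k ≢ suc i → Joins (lookup H k) x y → x ≢ w → y ≢ w → ψ x ≡ ψ y
    mono′ {zero}  _   jk = mono (vc (new-edge jk))
    mono′ {suc k} k≢i jk with joins-H⁻ k jk
    ... | x′ , y′ , j′ , m = mono (surgery-moved ((origin k , j′) , other) m)
      where
      other : ¬ SamePair x′ y′ s t
      other same = k≢i (cong suc (map-index-injective _ G
        (no-parallel j′ (joins-resp {e = lookup G (origin i)} same j))))

  H-critical : ∀ i → CriticalAt i
  -- Without vc, the vertex v hangs on u alone.
  H-critical zero = u , singleton v , v , c , (u≢v ∘ sym) , (u≢c ∘ sym) , singleton-differs (v≢c ∘ sym) , mono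
    where
    mono : ∀ {k x y} → k ≢ zero → Joins (lookup H k) x y → x ≢ u → y ≢ u → singleton v x ≡ singleton v y
    mono {zero}  k≢0 = contradiction refl k≢0
    mono {suc k} _ jk x≢u y≢u with joins-H⁻ k jk
    ... | _ , _ , _ , near nx ny refl refl            = not-v (v≢near nx) (v≢near ny)
    ... | _ , _ , _ , far fx fy refl refl             = not-v (transposed≢v fx) (transposed≢v fy)
    ... | _ , _ , _ , uv (inj₁ (refl , _)) refl _     = contradiction refl x≢u
    ... | _ , _ , _ , uv (inj₂ (_ , refl)) _ refl     = contradiction refl y≢u
  H-critical (suc i) with lookup G (origin i) in eq
  ... | edge s t s≢t = by-side (classify (origin i , j))
    where
    j : Joins (lookup G (origin i)) s t
    j rewrite eq = inj₁ (refl , refl)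

    by-side : (Nearu s × Nearu t) ⊎ (Nearv s × Nearv t) ⊎ SamePair s t u v → CriticalAt (suc i)
    by-side (inj₁ (ns , nt)) =
      critical-from i j (RingConnectivity.split-surgery r 2conn u≁c ns nt (origin i , j) (critical j))
    -- The split comes from the flipped ring and is carried over by the transposition.
    by-side (inj₂ (inj₁ (fs , ft)))
      with RingConnectivity.split-surgery (flip-ring r) 2conn v≁c fs ft (origin i , j) (critical j)
    ... | split w ψ mono s≢w t≢w differ = critical-from i j (split (τ w) (ψ ∘ τ⁻¹)
      (λ sg x≢ y≢ → mono (flip-surgery v≢c u≢c sg) (back x≢) (back y≢))
      (s≢w ∘ transpose-injective u v) (t≢w ∘ transpose-injective u v)
      λ eq′ → differ (trans (cong ψ (sym (transpose-inverse v u))) (trans eq′ (cong ψ (transpose-inverse v u)))))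
      where
      τ τ⁻¹ : Fin n → Fin n
      τ   = transpose u v
      τ⁻¹ = transpose v u
      back : ∀ {x} → x ≢ τ w → τ⁻¹ x ≢ w
      back x≢ refl = x≢ (sym (transpose-inverse u v))
    -- Without uv, the vertex v hangs on c alone.
    by-side (inj₂ (inj₂ same)) = c , singleton v , v , u , v≢c , u≢c , singleton-differs u≢v , mono
      where
      mono : ∀ {k x y} → k ≢ suc i → Joins (lookup H k) x y → x ≢ c → y ≢ c → singleton v x ≡ singleton v y
      mono {zero} _ jk x≢c y≢c with new-edge jk
      ... | inj₁ (_ , y≡c) = contradiction y≡c y≢c
      ... | inj₂ (x≡c , _) = contradiction x≡c x≢c
      mono {suc k} k≢i jk x≢c y≢c with joins-H⁻ k jk
      ... | _ , _ , _ , near nx ny refl refl = not-v (v≢near nx) (v≢near ny)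
      ... | _ , _ , _ , far fx fy refl refl  = not-v (transposed≢v fx) (transposed≢v fy)
      ... | _ , _ , j′ , uv same′ _ _        = contradiction
        (cong suc (map-index-injective _ G (no-parallel (joins-resp {e = lookup G (origin k)} (samePair-sym same′) j′)
                                             (joins-resp {e = lookup G (origin i)} (samePair-sym same) j)))) k≢i

  H-minimally-2-connected : MinimallyTwoConnected H
  H-minimally-2-connected = minimally-2-connected 4≤n H-noCutVertex H-cut
    (ℕ.≤-trans (∣p∪q∣≤∣p∣+∣q∣ ⁅ u ⁆ ⁅ c ⁆)
               (ℕ.≤-reflexive (cong₂ _+_ (Subset.∣⁅x⁆∣≡1 u) (Subset.∣⁅x⁆∣≡1 c)))) H-critical

-- Total connectivity

open Sum ℕ.+-0-commutativeMonoid using (sum; sum-remove; sum-cong-≗; ∑-distrib-+; ∑-comm)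

sum-mono-≤ : ∀ {n} {f g : Fin n → ℕ} → (∀ i → f i ≤ g i) → sum f ≤ sum g
sum-mono-≤ {zero}  f≤g = z≤n
sum-mono-≤ {suc n} f≤g = ℕ.+-mono-≤ (f≤g zero) (sum-mono-≤ (f≤g ∘ suc))

sum-mono-< : ∀ {n} {f g : Fin n → ℕ} → (∀ i → f i ≤ g i) → ∀ i → f i < g i → sum f < sum g
sum-mono-< {suc n} f≤g zero    f<g = ℕ.+-mono-<-≤ f<g (sum-mono-≤ (f≤g ∘ suc))
sum-mono-< {suc n} f≤g (suc i) f<g = ℕ.+-mono-≤-< (f≤g zero) (sum-mono-< (f≤g ∘ suc) i f<g)

sum-isolate-two : ∀ {n} {u v : Fin n} → u ≢ v → ∃ λ m → Σ (Fin m → Fin n) λ rest →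
  (∀ i → rest i ≢ u × rest i ≢ v) × (∀ f → sum f ≡ f u + f v + sum (f ∘ rest))
sum-isolate-two {suc zero} {zero} {zero} u≢v = contradiction refl u≢v
sum-isolate-two {suc (suc m)} {u} {v} u≢v = m , rest , avoids , isolate
  where
  v′ : Fin (suc m)
  v′ = punchOut u≢v
  rest : Fin m → Fin (suc (suc m))
  rest = punchIn u ∘ punchIn v′
  avoids : ∀ i → rest i ≢ u × rest i ≢ v
  avoids i = Fin.punchInᵢ≢i u _ , λ eq → Fin.punchInᵢ≢i v′ i
    (Fin.punchIn-injective u _ _ (trans eq (sym (Fin.punchIn-punchOut u≢v))))
  isolate : ∀ f → sum f ≡ f u + f v + sum (f ∘ rest)
  isolate f = begin
    sum f                                              ≡⟨ sum-remove {i = u} f ⟩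
    f u + sum (f ∘ punchIn u)                          ≡⟨ cong (f u +_) (sum-remove {i = v′} (f ∘ punchIn u)) ⟩
    f u + (f (punchIn u v′) + sum (f ∘ rest))          ≡⟨ cong (λ z → f u + (f z + sum (f ∘ rest))) (Fin.punchIn-punchOut u≢v) ⟩
    f u + (f v + sum (f ∘ rest))                       ≡⟨ ℕ.+-assoc (f u) (f v) _ ⟨
    f u + f v + sum (f ∘ rest)                         ∎
    where open ≡-Reasoning

module _ {n} {u v : Fin n} (u≢v : u ≢ v) {f g : Fin n → ℕ} (f≤g : ∀ z → z ≢ u → z ≢ v → f z ≤ g z) where

  -- The terms at u and v are compared only together, since for a vertex on the side of v the
  -- surgery exchanges them.
  sum-pair-≤ : f u + f v ≤ g u + g v → sum f ≤ sum g
  sum-pair-≤ le with sum-isolate-two u≢v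
  ... | m , rest , avoids , isolate = subst₂ _≤_ (sym (isolate f)) (sym (isolate g))
    (ℕ.+-mono-≤ le (sum-mono-≤ λ i → f≤g (rest i) (proj₁ (avoids i)) (proj₂ (avoids i))))

  sum-pair-< : f u + f v < g u + g v → sum f < sum g
  sum-pair-< lt with sum-isolate-two u≢v
  ... | m , rest , avoids , isolate = subst₂ _<_ (sym (isolate f)) (sym (isolate g))
    (ℕ.+-mono-<-≤ lt (sum-mono-≤ λ i → f≤g (rest i) (proj₁ (avoids i)) (proj₂ (avoids i))))

-- Counting every pair from both ends makes the sum symmetric, so the rows of u and v can be treated
-- like their columns, independently of the order of the vertices.
double-total : ∀ {n} (G : Graph n) →
  totalConnectivity G + totalConnectivity G ≡ sum λ x → sum λ y → conn G x y
double-total {n} G = begin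
  T + T                                                  ≡⟨ cong (T +_) (∑-comm p) ⟩
  T + sum (λ x → sum λ y → p y x)                        ≡⟨ ∑-distrib-+ (λ x → sum (p x)) (λ x → sum λ y → p y x) ⟨
  sum (λ x → sum (p x) + sum (λ y → p y x))              ≡⟨ sum-cong-≗ (λ x → ∑-distrib-+ (p x) (λ y → p y x)) ⟨
  sum (λ x → sum λ y → conn G x y)                       ∎
  where
  open ≡-Reasoning
  p : Fin n → Fin n → ℕ
  p = pairConnectivity G
  T : ℕ
  T = totalConnectivity G

weaken-route : ∀ {n} {E F : Rel n} → (∀ {x y} → E x y → F x y) → ∀ {x p y} → Route E x p y → Route F x p y
weaken-route E⇒F (direct e) = direct (E⇒F e)
weaken-route E⇒F (via e r)  = via (E⇒F e) (weaken-route E⇒F r)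

weaken-path : ∀ {n} {E F : Rel n} → (∀ {x y} → E x y → F x y) → ∀ {x p y} → IsPath E x y p → IsPath F x y p
weaken-path E⇒F (isPath r x∉ y∉ p!) = isPath (weaken-route E⇒F r) x∉ y∉ p!

module Comparison {n} (4≤n : 4 ≤ n) .{{_ : NonTrivial n}} (G : Graph n) (minimalG : Minimal G)
  {φ : Fin n → Bool} {c u v : Fin n} (r : Ring (Adj G) φ c u v)
  (u≁c : ¬ Adj G u c) (v≁c : ¬ Adj G v c) where

  open Minimal minimalG
  open Ring r
  open RingProperties r
  open SurgeryGraph 4≤n G minimalG r u≁c v≁c
  open SurgeryPaths r u≁c v≁c using (Kept; near-family)
  open CrossPaths r u≁c v≁c using (far-family; cross-family; hub-family; spoke-family)

  private
    S : Rel n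
    S = Surgery (Adj G) φ c u v
    τ : Fin n → Fin n
    τ = transpose u v
    3≤n : 3 ≤ n
    3≤n = ℕ.≤-trans (ℕ.n≤1+n 3) 4≤n

  family≤conn-H : ∀ {x y ps} → x ≢ y → Family S x y ps → length ps ≤ conn H x y
  family≤conn-H x≢y (paths , apart) =
    family≤conn {G = H} x≢y (ListAll.map (weaken-path surgery⇒H) paths , apart)

  transfer : ∀ {x y x′ y′} → x ≢ y → x′ ≢ y′ →
    (∀ {ps} → Family (Adj G) x y ps → ∃ λ qs → Family S x′ y′ qs × length qs ≡ length ps) →
    conn G x y ≤ conn H x′ y′
  transfer x≢y x′≢y′ f with conn-family {G = G} no-parallel x≢y
  ... | ps , F , len with f F
  ...   | qs , F′ , len′ = subst (_≤ _) (trans len′ len) (family≤conn-H x′≢y′ F′)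

  near-conn : ∀ {x y} → x ≢ y → Kept x → Kept y → ¬ SamePair x y v c → conn G x y ≤ conn H x y
  near-conn x≢y Kx Ky not-vc = transfer x≢y x≢y (near-family x≢y Kx Ky not-vc)

  far-conn : ∀ {x y} → x ≢ y → Nearv x ⊎ x ≡ u → Nearv y ⊎ y ≡ u → ¬ SamePair x y u c →
             conn G x y ≤ conn H (τ x) (τ y)
  far-conn x≢y Kx Ky not-uc = transfer x≢y (x≢y ∘ transpose-injective u v) (far-family x≢y Kx Ky not-uc)

  H-path : ∀ {x y} → x ≢ y → ∃ (IsPath S x y)
  H-path {x} {y} x≢y
    with p , _ ← noCutVertex⇒connected {G = H} 3≤n H-noCutVertex {Subset.⊥}
                   (ℕ.≤-trans (ℕ.≤-reflexive (Subset.∣⊥∣≡0 n)) z≤n) x y Subset.∉⊥ Subset.∉⊥ =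
    _ , weaken-path H⇒surgery (Interior.is-path (path-interior x≢y p))

  cross-conn : ∀ {x y} → Nearu x → x ≢ c → x ≢ u → Nearv y → y ≢ c → y ≢ v → conn G x y ≤ conn H x y
  cross-conn {x} {y} nx x≢c x≢u fy y≢c y≢v =
    transfer x≢y x≢y (cross-family nx x≢c x≢u fy y≢c y≢v (H-path x≢y))
    where
    x≢y : x ≢ y
    x≢y refl = x≢c (both-sides nx fy)

  u-v-avoiding-pair : ∀ {x y} → x ≢ u → x ≢ v → y ≢ u → y ≢ v → x ≢ y → conn G x y ≤ conn H x y
  u-v-avoiding-pair {x} {y} x≢u x≢v y≢u y≢v x≢y = by-side (side x) (side y) (x ≟ c) (y ≟ c)
    where
    near-near : Nearu x → Nearu y → conn G x y ≤ conn H x y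
    near-near nx ny = near-conn x≢y (inj₁ nx) (inj₁ ny)
      [ (λ (x≡v , _) → x≢v x≡v) , (λ (_ , y≡v) → y≢v y≡v) ]
    far-far : Nearv x → Nearv y → conn G x y ≤ conn H x y
    far-far fx fy = subst₂ (λ a b → conn G x y ≤ conn H a b)
      (transpose-other u v x≢u x≢v) (transpose-other u v y≢u y≢v)
      (far-conn x≢y (inj₁ fx) (inj₁ fy) [ (λ (x≡u , _) → x≢u x≡u) , (λ (_ , y≡u) → y≢u y≡u) ])
    by-side : Nearu x ⊎ Nearv x → Nearu y ⊎ Nearv y → Dec (x ≡ c) → Dec (y ≡ c) → conn G x y ≤ conn H x y
    by-side (inj₁ nx) (inj₁ ny) _          _          = near-near nx ny
    by-side (inj₂ fx) (inj₂ fy) _          _          = far-far fx fy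
    -- As c lies on both sides, it is counted with the side of its partner.
    by-side (inj₁ nx) (inj₂ fy) (yes x≡c)  _          = far-far (inj₁ x≡c) fy
    by-side (inj₁ nx) (inj₂ fy) (no x≢c)   (yes y≡c)  = near-near nx (inj₁ y≡c)
    by-side (inj₁ nx) (inj₂ fy) (no x≢c)   (no y≢c)   = cross-conn nx x≢c x≢u fy y≢c y≢v
    by-side (inj₂ fx) (inj₁ ny) (yes x≡c)  _          = near-near (inj₁ x≡c) ny
    by-side (inj₂ fx) (inj₁ ny) (no x≢c)   (yes y≡c)  = far-far fx (inj₁ y≡c)
    by-side (inj₂ fx) (inj₁ ny) (no x≢c)   (no y≢c)   =
      subst₂ _≤_ (conn-sym {G = G} y x) (conn-sym {G = H} y x) (cross-conn ny y≢c y≢u fx x≢c x≢v)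

  hub-gain : conn G u c + conn G v c < conn H u c + conn H v c
  hub-gain with conn-family {G = G} no-parallel u≢c | conn-family {G = G} no-parallel v≢c
  ... | ps , Fu , lu | qs , Fv , lv with hub-family Fu Fv
  ...   | rs , F , bound = begin-strict
    conn G u c + conn G v c ≡⟨ cong₂ _+_ lu lv ⟨
    length ps + length qs   ≤⟨ bound ⟩
    1 + length rs           <⟨ ℕ.≤-refl ⟩
    2 + length rs           ≡⟨ ℕ.+-comm 2 (length rs) ⟩
    length rs + 2           ≤⟨ ℕ.+-mono-≤ (family≤conn-H u≢c F) spokes ⟩
    conn H u c + conn H v c ∎
    where
    open ℕ.≤-Reasoning
    spokes : 2 ≤ conn H v c
    -- A path from u to c that avoids v stays on the side of u and so survives the surgery. Prefixed
    -- by vu, it joins the edge vc as the second path from v to c.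
    spokes with p , p∌v ← noCutVertex⇒connected {G = G} 3≤n 2conn {⁅ v ⁆} (ℕ.≤-reflexive (Subset.∣⁅x⁆∣≡1 v)) u c
                            (Subset.x≢y⇒x∉⁅y⁆ u≢v) (Subset.x≢y⇒x∉⁅y⁆ (v≢c ∘ sym)) =
      family≤conn-H v≢c (spoke-family (Interior.is-path P) λ v∈ →
        All.lookup p∌v (Interior.inside P v∈) (Subset.x∈⁅x⁆ v))
      where
      P : Interior G (walk p)
      P = path-interior u≢c p

  pair-gain : ∀ z → conn G u z + conn G v z ≤ conn H u z + conn H v z
  pair-gain z with z ≟ u | z ≟ v | z ≟ c
  ... | yes refl | _ | _ rewrite conn-self {G = G} u | conn-self {G = H} u =
    near-conn (u≢v ∘ sym) (inj₂ refl) (inj₁ u-near) [ (λ (_ , u≡c) → u≢c u≡c) , (λ (v≡c , _) → v≢c v≡c) ]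
  ... | no _ | yes refl | _ rewrite conn-self {G = G} v | conn-self {G = H} v = ℕ.+-monoˡ-≤ 0
    (near-conn u≢v (inj₁ u-near) (inj₂ refl) [ (λ (u≡v , _) → u≢v u≡v) , (λ (u≡c , _) → u≢c u≡c) ])
  ... | no _ | no _ | yes refl = ℕ.<⇒≤ hub-gain
  ... | no z≢u | no z≢v | no z≢c with side z
  ...   | inj₁ nz = ℕ.+-mono-≤
    (near-conn (z≢u ∘ sym) (inj₁ u-near) (inj₁ nz) [ (λ (u≡v , _) → u≢v u≡v) , (λ (u≡c , _) → u≢c u≡c) ])
    (near-conn (z≢v ∘ sym) (inj₂ refl) (inj₁ nz) [ (λ (_ , z≡c) → z≢c z≡c) , (λ (v≡c , _) → v≢c v≡c) ])
  ...   | inj₂ fz = ℕ.≤-trans (ℕ.+-mono-≤ u-to-v v-to-u) (ℕ.≤-reflexive (ℕ.+-comm (conn H v z) (conn H u z)))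
    where
    τz≡z : τ z ≡ z
    τz≡z = transpose-other u v z≢u z≢v
    u-to-v : conn G u z ≤ conn H v z
    u-to-v = subst₂ (λ a b → conn G u z ≤ conn H a b) (transpose-l u v) τz≡z
      (far-conn (z≢u ∘ sym) (inj₂ refl) (inj₁ fz) [ (λ (_ , z≡c) → z≢c z≡c) , (λ (u≡c , _) → u≢c u≡c) ])
    v-to-u : conn G v z ≤ conn H u z
    v-to-u = subst₂ (λ a b → conn G v z ≤ conn H a b) (transpose-r u v) τz≡z
      (far-conn (z≢v ∘ sym) (inj₁ v-far) (inj₁ fz) [ (λ (v≡u , _) → u≢v (sym v≡u)) , (λ (v≡c , _) → v≢c v≡c) ])

  row-gain : ∀ x → x ≢ u → x ≢ v → sum (conn G x) ≤ sum (conn H x)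
  row-gain x x≢u x≢v = sum-pair-≤ u≢v others
    (subst₂ _≤_ (cong₂ _+_ (conn-sym {G = G} u x) (conn-sym {G = G} v x))
                (cong₂ _+_ (conn-sym {G = H} u x) (conn-sym {G = H} v x)) (pair-gain x))
    where
    others : ∀ z → z ≢ u → z ≢ v → conn G x z ≤ conn H x z
    others z z≢u z≢v with x ≟ z
    ... | yes refl rewrite conn-self {G = G} x = z≤n
    ... | no x≢z   = u-v-avoiding-pair x≢u x≢v z≢u z≢v x≢z

  total-increases : totalConnectivity G < totalConnectivity H
  total-increases = ℕ.≰⇒> λ le → ℕ.<⇒≱ doubled (ℕ.+-mono-≤ le le)
    where
    rows : sum (conn G u) + sum (conn G v) < sum (conn H u) + sum (conn H v)
    rows = subst₂ _<_ (∑-distrib-+ (conn G u) (conn G v)) (∑-distrib-+ (conn H u) (conn H v))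
      (sum-mono-< pair-gain c hub-gain)
    doubled : totalConnectivity G + totalConnectivity G < totalConnectivity H + totalConnectivity H
    doubled = subst₂ _<_ (sym (double-total G)) (sym (double-total H)) (sum-pair-< u≢v row-gain rows)

-- Reduction to lowest terms may destroy the common denominator, so the comparison is made between
-- unnormalised fractions.
/-cancelʳ-≤ : ∀ {a b} d .{{_ : NonZero d}} → (ℤ.+ a) ℚ./ d ℚ.≤ (ℤ.+ b) ℚ./ d → a ≤ b
/-cancelʳ-≤ {a} {b} (suc d) le = unnormalised (ℚᵘ.≤-respʳ-≃ (ℚ.toℚᵘ-fromℚᵘ (ℚᵘ.mkℚᵘ (ℤ.+ b) d))
    (ℚᵘ.≤-respˡ-≃ (ℚ.toℚᵘ-fromℚᵘ (ℚᵘ.mkℚᵘ (ℤ.+ a) d)) (ℚ.toℚᵘ-mono-≤ le)))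
  where
  unnormalised : ℚᵘ.mkℚᵘ (ℤ.+ a) d ℚᵘ.≤ ℚᵘ.mkℚᵘ (ℤ.+ b) d → a ≤ b
  unnormalised (ℚᵘ.*≤* le) = ℤ.drop‿+≤+ (ℤ.*-cancelʳ-≤-pos (ℤ.+ a) (ℤ.+ b) (ℤ.+ suc d) le)

optimal⇒no-ring : ∀ {n} .{{_ : NonTrivial n}} → 4 ≤ n → (G : Graph n) → Optimal G →
  ∀ {φ c u v} → Ring (Adj G) φ c u v → ¬ Adj G u c → ¬ Adj G v c → ⊥
optimal⇒no-ring {n} 4≤n G (minimallyG , best) r u≁c v≁c =
  ℕ.<⇒≱ total-increases (/-cancelʳ-≤ (n C 2) {{nC2-nonZero n}} (best H H-minimally-2-connected))
  where
  minimalG : Minimal G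
  minimalG = minimal 4≤n minimallyG
  open SurgeryGraph 4≤n G minimalG r u≁c v≁c using (H; H-minimally-2-connected)
  open Comparison 4≤n G minimalG r u≁c v≁c using (total-increases)

-- Degrees

length-filter-map : ∀ {A B : Set} {P : B → Set} (P? : Decidable P) (f : A → B) xs →
  length (filter P? (map f xs)) ≡ length (filter (P? ∘ f) xs)
length-filter-map P? f []       = refl
length-filter-map P? f (x ∷ xs) with does (P? (f x))
... | true  = cong suc (length-filter-map P? f xs)
... | false = length-filter-map P? f xs

-- Positions, unlike the edges filtered by `degree`, never repeat, which makes them fit for
-- counting.
incidences : ∀ {n} (G : Graph n) → Fin n → List (EdgeOf G)
incidences G x = filter (incident? x ∘ lookup G) (allFin (length G))

degree≡length : ∀ {n} (G : Graph n) x → degree G x ≡ length (incidences G x)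
degree≡length G x = trans
  (cong (length ∘ filter (incident? x)) (sym (trans (List.map-tabulate id (lookup G)) (List.tabulate-lookup G))))
  (length-filter-map (incident? x) (lookup G) (allFin (length G)))

members : ∀ {n} → List (Fin n) → Fin n → Bool
members xs z = does (ListDec._∈?_ _≟_ z xs)

module _ {n} {xs : List (Fin n)} where

  ∈-members : ∀ {z} → z ∈ xs → members xs z ≡ true
  ∈-members {z} = dec-true (ListDec._∈?_ _≟_ z xs)

  ∉-members : ∀ {z} → z ∉ xs → members xs z ≡ false
  ∉-members {z} = dec-false (ListDec._∈?_ _≟_ z xs)

module Degrees {n} (5≤n : 5 ≤ n) {G : Graph n} (minimalG : Minimal G) where

  open Minimal minimalG

  incidences-unique : ∀ x → List.Unique (incidences G x)
  incidences-unique x = ListUnique.filter⁺ (incident? x ∘ lookup G) {xs = allFin (length G)} (ListUnique.allFin⁺ (length G))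

  ∈-incidences : ∀ {x y i} → Joins (lookup G i) x y → i ∈ incidences G x
  ∈-incidences {x} {i = i} j = ∈-filter⁺ (incident? x ∘ lookup G) (∈-allFin i) (incident {e = lookup G i} j)
    where
    incident : ∀ {e : Edge n} {y} → Joins e x y → Incident x e
    incident (inj₁ (s≡x , _)) = inj₁ s≡x
    incident (inj₂ (_ , t≡x)) = inj₂ t≡x

  other-end : ∀ {x i} → i ∈ incidences G x → ∃ λ y → Joins (lookup G i) x y
  other-end {x} {i} i∈ with proj₂ (∈-filter⁻ (incident? x ∘ lookup G) {xs = allFin (length G)} i∈)
  ... | inj₁ s≡x = target (lookup G i) , inj₁ (s≡x , refl)
  ... | inj₂ t≡x = source (lookup G i) , inj₂ (refl , t≡x)

  -- A proper set of vertices with all exits through w is cut off by w.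
  not-cut-off : ∀ xs w → (∀ {x y} → x ∈ xs → Adj G x y → y ∈ xs ⊎ y ≡ w) →
                ∀ {x} → x ∈ xs → x ≢ w → length xs < 4 → ⊥
  -- `w` and at most three vertices of `xs` leave out a fifth vertex, which lies on the other side
  -- of the cut.
  not-cut-off xs w closed {x} x∈ x≢w short with fresh (w ∷ xs) (ℕ.≤-trans (s≤s short) 5≤n)
  ... | z , z∉ = contradiction (trans (sym (∈-members x∈))
    (trans (2conn w (members xs) mono x≢w (z∉ ∘ here)) (∉-members (z∉ ∘ there)))) λ ()
    where
    mono : Monochromatic (Adj G) (_≢ w) (members xs)
    mono {a} {b} e a≢w b≢w with ListDec._∈?_ _≟_ a xs | ListDec._∈?_ _≟_ b xs
    ... | yes _  | yes _  = refl
    ... | no _   | no _   = refl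
    ... | yes a∈ | no b∉ = ⊥-elim ([ b∉ , b≢w ] (closed a∈ e))
    ... | no a∉  | yes b∈ = ⊥-elim ([ a∉ , a≢w ] (closed b∈ (adj-sym {G = G} e)))

  -- A vertex with at most one neighbour is cut off by that neighbour, or by an arbitrary vertex if
  -- it has none.
  degree≥2 : ∀ x → 2 ≤ degree G x
  degree≥2 x rewrite degree≡length G x = go (incidences G x) refl
    where
    pendant : ∀ w → w ≢ x → (∀ {y} → Adj G x y → y ≡ w) → ⊥
    pendant w w≢x only = not-cut-off (x ∷ []) w (λ { (here refl) a → inj₂ (only a) }) (here refl) (w≢x ∘ sym)
      (s≤s (s≤s z≤n))
    go : ∀ is → incidences G x ≡ is → 2 ≤ length is
    go [] eq with fresh (x ∷ []) (ℕ.≤-trans (s≤s (s≤s z≤n)) 5≤n)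
    ... | w , w∉ = ⊥-elim (pendant w (w∉ ∘ here) λ (i , j) → none (subst (i ∈_) eq (∈-incidences j)))
      where
      none : ∀ {i : EdgeOf G} {A : Set} → i ∈ [] → A
      none ()
    go (i ∷ []) eq with other-end (subst (i ∈_) (sym eq) (here refl))
    ... | w , jw = ⊥-elim (pendant w (λ { refl → joins-irr {e = lookup G i} jw }) only)
      where
      only : ∀ {y} → Adj G x y → y ≡ w
      only (k , jk) with subst (k ∈_) eq (∈-incidences jk)
      ... | here refl with joins-unique {e = lookup G i} jk jw
      ...   | inj₁ (_ , y≡w)    = y≡w
      ...   | inj₂ (x≡w , y≡x)  = trans y≡x x≡w
    go (_ ∷ _ ∷ _) _ = s≤s (s≤s z≤n)

  degree-2-neighbours : ∀ {x} → degree G x ≡ 2 → ∀ {a} → Adj G x a →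
    ∃ λ b → Adj G x b × b ≢ a × (∀ {y} → Adj G x y → y ≡ a ⊎ y ≡ b)
  degree-2-neighbours {x} deg {a} (k , jk) =
    go (incidences G x) refl (trans (sym (degree≡length G x)) deg) (incidences-unique x)
    where
    Result : Set
    Result = ∃ λ b → Adj G x b × b ≢ a × (∀ {y} → Adj G x y → y ≡ a ⊎ y ≡ b)

    two-edges : ∀ {l} → l ∈ incidences G x → l ≢ k → (∀ {i} → i ∈ incidences G x → i ≡ k ⊎ i ≡ l) → Result
    two-edges {l} l∈ l≢k only with other-end l∈
    ... | b , jl = b , (l , jl) , (λ { refl → l≢k (no-parallel jl jk) }) , neighbour
      where
      same-end : ∀ {i y z} → Joins (lookup G i) x y → Joins (lookup G i) x z → y ≡ z
      same-end {i} jy jz with joins-unique {e = lookup G i} jy jz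
      ... | inj₁ (_ , y≡z)   = y≡z
      ... | inj₂ (x≡z , y≡x) = trans y≡x x≡z
      neighbour : ∀ {y} → Adj G x y → y ≡ a ⊎ y ≡ b
      neighbour (i , ji) with only (∈-incidences ji)
      ... | inj₁ refl = inj₁ (same-end ji jk)
      ... | inj₂ refl = inj₂ (same-end ji jl)

    go : ∀ is → incidences G x ≡ is → length is ≡ 2 → List.Unique is → Result
    go (i ∷ j ∷ []) eq _ ((i≢j ∷ []) ∷ _) with subst (k ∈_) eq (∈-incidences jk)
    ... | here refl         = two-edges (subst (j ∈_) (sym eq) (there (here refl))) (i≢j ∘ sym)
      λ l∈ → cases (subst (_ ∈_) eq l∈)
      where
      cases : ∀ {l} → l ∈ i ∷ j ∷ [] → l ≡ i ⊎ l ≡ j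
      cases (here p)         = inj₁ p
      cases (there (here p)) = inj₂ p
    ... | there (here refl) = two-edges (subst (i ∈_) (sym eq) (here refl)) i≢j
      λ l∈ → cases (subst (_ ∈_) eq l∈)
      where
      cases : ∀ {l} → l ∈ i ∷ j ∷ [] → l ≡ j ⊎ l ≡ i
      cases (here p)         = inj₂ p
      cases (there (here p)) = inj₁ p

  -- Otherwise three edges at `x` all lead to `a` or `b`, and two of them are parallel.
  third-neighbour : ∀ {x} → degree G x > 2 → ∀ a b → ∃ λ y → Adj G x y × y ≢ a × y ≢ b
  third-neighbour {x} deg a b with any? (λ y → adj? G x y ×-dec ¬? (y ≟ a) ×-dec ¬? (y ≟ b))
  ... | yes found = found
  ... | no none   = ⊥-elim (go (incidences G x) refl (subst (2 <_) (degree≡length G x) deg) (incidences-unique x))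
    where
    a-or-b : ∀ {i} → i ∈ incidences G x → Joins (lookup G i) x a ⊎ Joins (lookup G i) x b
    a-or-b {i} i∈ with other-end i∈
    ... | y , j with y ≟ a | y ≟ b
    ...   | yes refl | _        = inj₁ j
    ...   | no _     | yes refl = inj₂ j
    ...   | no y≢a   | no y≢b   = contradiction (y , (i , j) , y≢a , y≢b) none

    go : ∀ is → incidences G x ≡ is → 2 < length is → List.Unique is → ⊥
    go (_ ∷ [])     eq (s≤s ())
    go (_ ∷ _ ∷ []) eq (s≤s (s≤s ()))
    go (i ∷ j ∷ k ∷ _) eq _ ((i≢j ∷ i≢k ∷ _) ∷ (j≢k ∷ _) ∷ _)
      with a-or-b (subst (i ∈_) (sym eq) (here refl))
         | a-or-b (subst (j ∈_) (sym eq) (there (here refl)))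
         | a-or-b (subst (k ∈_) (sym eq) (there (there (here refl))))
    ... | inj₁ p | inj₁ q | _      = i≢j (no-parallel p q)
    ... | inj₂ p | inj₂ q | _      = i≢j (no-parallel p q)
    ... | inj₁ p | inj₂ _ | inj₁ q = i≢k (no-parallel p q)
    ... | inj₂ p | inj₁ _ | inj₂ q = i≢k (no-parallel p q)
    ... | inj₁ _ | inj₂ p | inj₂ q = j≢k (no-parallel p q)
    ... | inj₂ _ | inj₁ p | inj₁ q = j≢k (no-parallel p q)

  chordless : ∀ {φ c u v u′} → Ring (Adj G) φ c u v → Adj G u u′ → u′ ≢ v → u′ ≢ c → ¬ Adj G u c
  chordless r = RingChords.no-chord r 2conn λ (_ , j) → critical j

  NoRing : Set
  NoRing = ∀ {φ c u v} → Ring (Adj G) φ c u v → ¬ Adj G u c → ¬ Adj G v c → ⊥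

  adjacent-large-degrees : NoRing → ∀ {u v} → Adj G u v → degree G u > 2 → degree G v > 2 → ⊥
  adjacent-large-degrees no-ring {u} {v} (i , j) degu degv with critical j
  ... | split c φ mono u≢c v≢c φu≢φv =
    no-ring r (corner r (third-neighbour degu v c)) (corner (flip-ring r) (third-neighbour degv u c))
    where
    -- The degree hypothesis enters here: a neighbour other than v and c provides the cycle of which
    -- uc would be a chord.
    corner : ∀ {φ c u v} → Ring (Adj G) φ c u v → (∃ λ y → Adj G u y × y ≢ v × y ≢ c) → ¬ Adj G u c
    corner r (y , a , y≢v , y≢c) = chordless r a y≢v y≢c

    cross : ∀ {x y} → Adj G x y → x ≢ c → y ≢ c → φ x ≡ φ y ⊎ SamePair x y u v
    cross {x} {y} a x≢c y≢c with ((x ≟ u) ×-dec (y ≟ v)) ⊎-dec ((x ≟ v) ×-dec (y ≟ u))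
    ... | yes same = inj₂ same
    ... | no other = inj₁ (mono (a , other) x≢c y≢c)

    r : Ring (Adj G) φ c u v
    r = record { symm = adj-sym {G = G} ; irr = adj-irr {G = G} ; u~v = i , j
               ; u≢c = u≢c ; v≢c = v≢c ; φu≢φv = φu≢φv ; cross = cross }

  -- With a and b the other neighbours of x and y, the surgery turns the path
  -- a x y b into the 4-cycle a x b y.
  adjacent-degrees-2 : NoRing → ∀ {x y} → Adj G x y → degree G x ≡ 2 → degree G y ≡ 2 → ⊥
  adjacent-degrees-2 no-ring {x} {y} xy degx degy
    with degree-2-neighbours degx xy | degree-2-neighbours degy (adj-sym {G = G} xy)
  ... | a , xa , a≢y , only-x | b , yb , b≢x , only-y = no-ring r a≁b x≁b
    where
    loop≢ : ∀ {s t} → Adj G s t → t ≢ s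
    loop≢ st refl = adj-irr {G = G} st

    side : List (Fin n)
    side = x ∷ y ∷ []

    a≢x : a ≢ x
    a≢x = loop≢ xa

    a∉side : a ∉ side
    a∉side (here a≡x)         = a≢x a≡x
    a∉side (there (here a≡y)) = a≢y a≡y

    -- Otherwise a would cut {x, y} off from the rest.
    a≢b : a ≢ b
    a≢b refl = not-cut-off side a closed (here refl) (a≢x ∘ sym) (s≤s (s≤s (s≤s z≤n)))
      where
      closed : ∀ {s t} → s ∈ side → Adj G s t → t ∈ side ⊎ t ≡ a
      closed (here refl) st with only-x st
      ... | inj₁ refl = inj₁ (there (here refl))
      ... | inj₂ t≡a  = inj₂ t≡a
      closed (there (here refl)) st with only-y st
      ... | inj₁ refl = inj₁ (here refl)
      ... | inj₂ t≡b  = inj₂ t≡b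

    exit : ∀ {s t} → s ∈ side → t ∉ side → t ≢ b → Adj G s t → s ≡ x × t ≡ a
    exit (here refl) t∉ t≢b st with only-x st
    ... | inj₁ refl = contradiction (there (here refl)) t∉
    ... | inj₂ t≡a  = refl , t≡a
    exit (there (here refl)) t∉ t≢b st with only-y st
    ... | inj₁ refl = contradiction (here refl) t∉
    ... | inj₂ t≡b  = contradiction t≡b t≢b

    -- Once b is deleted, xa is the only edge leaving {x, y}, so membership in that set colours the
    -- ring.
    cross : ∀ {s t} → Adj G s t → s ≢ b → t ≢ b → members side s ≡ members side t ⊎ SamePair s t a x
    cross {s} {t} st s≢b t≢b = go (ListDec._∈?_ _≟_ s side) (ListDec._∈?_ _≟_ t side)
      where
      go : Dec (s ∈ side) → Dec (t ∈ side) → members side s ≡ members side t ⊎ SamePair s t a x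
      go (yes s∈) (yes t∈) = inj₁ (trans (∈-members s∈) (sym (∈-members t∈)))
      go (no s∉)  (no t∉)  = inj₁ (trans (∉-members s∉) (sym (∉-members t∉)))
      go (yes s∈) (no t∉) with s≡x , t≡a ← exit s∈ t∉ t≢b st = inj₂ (inj₂ (s≡x , t≡a))
      go (no s∉)  (yes t∈) with t≡x , s≡a ← exit t∈ s∉ s≢b (adj-sym {G = G} st) = inj₂ (inj₁ (s≡a , t≡x))

    differ : members side a ≢ members side x
    differ eq with () ← trans (sym (∉-members {xs = side} a∉side)) (trans eq (∈-members {xs = side} (here refl)))

    r : Ring (Adj G) (members side) b a x
    r = record { symm = adj-sym {G = G} ; irr = adj-irr {G = G} ; u~v = adj-sym {G = G} xa
               ; u≢c = a≢b ; v≢c = b≢x ∘ sym ; φu≢φv = differ ; cross = cross }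

    x≁b : ¬ Adj G x b
    x≁b xb = [ loop≢ yb , (a≢b ∘ sym) ] (only-x xb)

    -- Otherwise b would cut {a, x, y} off from a fifth vertex. This fails in the 4-cycle a x y b,
    -- where a has only the neighbours x and b.
    third : ∃ λ z → Adj G a z × z ≢ x × z ≢ b
    third with any? (λ z → adj? G a z ×-dec ¬? (z ≟ x) ×-dec ¬? (z ≟ b))
    ... | yes found = found
    ... | no none = ⊥-elim (not-cut-off (a ∷ side) b closed (here refl) a≢b (s≤s (s≤s (s≤s (s≤s z≤n)))))
      where
      closed : ∀ {s t} → s ∈ a ∷ side → Adj G s t → t ∈ a ∷ side ⊎ t ≡ b
      closed {t = t} (here refl) st with t ≟ x | t ≟ b
      ... | yes refl | _       = inj₁ (there (here refl))
      ... | no _     | yes t≡b = inj₂ t≡b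
      ... | no t≢x   | no t≢b  = contradiction (t , st , t≢x , t≢b) none
      closed (there (here refl)) st with only-x st
      ... | inj₁ refl = inj₁ (there (there (here refl)))
      ... | inj₂ refl = inj₁ (here refl)
      closed (there (there (here refl))) st with only-y st
      ... | inj₁ refl = inj₁ (there (here refl))
      ... | inj₂ t≡b  = inj₂ t≡b

    a≁b : ¬ Adj G a b
    a≁b with third
    ... | z , az , z≢x , z≢b = chordless r az z≢x z≢b

theorem2p6 : (n : ℕ) .{{_ : NonTrivial n}} → n ≥ 5 →
    (G : Graph n) → Optimal G →
    BipartiteWithPartiteSets G (λ v → degree G v ≡ 2) (λ v → degree G v > 2)
theorem2p6 n n≥5 G optimal = record
  { cover    = two-or-more
  ; disjoint = λ v (deg≡2 , deg>2) → ℕ.<⇒≢ deg>2 (sym deg≡2)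
  ; crossing = crossing }
  where
  4≤n : 4 ≤ n
  4≤n = ℕ.≤-trans (ℕ.n≤1+n 4) n≥5

  open Degrees n≥5 {G} (minimal 4≤n (proj₁ optimal))

  no-ring : NoRing
  no-ring = optimal⇒no-ring 4≤n G optimal

  two-or-more : ∀ v → degree G v ≡ 2 ⊎ degree G v > 2
  two-or-more v with ℕ.m≤n⇒m<n∨m≡n (degree≥2 v)
  ... | inj₁ 2<deg = inj₂ 2<deg
  ... | inj₂ 2≡deg = inj₁ (sym 2≡deg)

  crossing : ∀ (e : EdgeOf G) u v → Joins (lookup G e) u v →
             (degree G u ≡ 2 × degree G v > 2) ⊎ (degree G u > 2 × degree G v ≡ 2)
  crossing e u v j with two-or-more u | two-or-more v
  ... | inj₁ du | inj₂ dv = inj₁ (du , dv)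
  ... | inj₂ du | inj₁ dv = inj₂ (du , dv)
  ... | inj₁ du | inj₁ dv = ⊥-elim (adjacent-degrees-2 no-ring (e , j) du dv)
  ... | inj₂ du | inj₂ dv = ⊥-elim (adjacent-large-degrees no-ring (e , j) du dv)
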